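{- Let $\lambda\ge\kappa$ be infinite cardinals and let $(B_i:i\in I)$ be a family of boolean algebras each of which has the $(\lambda,\kappa)$-FN. Then the coproduct $B=\coprod_{i\in I}B_i$ (in the category of boolean algebras) has the $(\lambda,\kappa)$-FN.
   Context: For infinite cardinals $\lambda\ge\kappa$, a partial order $P$ has the $(\lambda,\kappa)$-FN iff there is a map $(f,g)\colon P\to[P]^{<\lambda}\times[P]^{<\kappa}$ such that for all $p\le q$ in $P$ there exist $r\in f(p)\cap g(q)$ with $p\le r\le q$ and $s\in g(p)\cap f(q)$ with $p\le s\le q$. Here $[P]^{<\mu}$ is the set of subsets of $P$ of cardinality less than $\mu$. A boolean algebra has the $(\lambda,\kappa)$-FN iff its underlying partial order does. The coproduct of boolean algebras is also known as their free product. -}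

module Defs where

open import Level using (Level; Setω; _⊔_; suc)
open import Algebra.Lattice.Bundles using (BooleanAlgebra)
open import Algebra.Lattice.Morphism.Structures using (IsLatticeHomomorphism)
import Algebra.Lattice.Properties.BooleanAlgebra as BooleanAlgebraProperties
open import Data.Nat.Base using (ℕ)
open import Data.Product.Base using (Σ; Σ-syntax; ∃-syntax; _×_; _,_; proj₁; proj₂; swap)
open import Function.Base using (id; _∘_)
open import Function.Bundles using (Func; Injection)
open import Function.Definitions using (StrictlySurjective; StrictlyInverseˡ)
open import Relation.Binary.Bundles using (Setoid; Poset)
import Relation.Binary.Construct.On as On
open import Relation.Binary.Definitions using (_Respects_)
open import Relation.Binary.PropositionalEquality.Properties using (setoid)
open import Relation.Nullary.Negation using (¬_)
open import Relation.Unary using (Pred; _∈_; _≐_)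

private
  variable
    a b c ℓ ℓ₁ ℓ₂ u v u′ v′ : Level

-- The mathematics takes place in ZFC.  A set is represented by a setoid, and
-- the axiom of choice says that every surjection of setoids has a section.
-- The section must respect the setoid equalities, so this is Zermelo's choice
-- and not the type-theoretic triviality; by Diaconescu's argument it
-- also yields excluded middle at every level.
AxiomOfChoice : Setω
AxiomOfChoice =
  ∀ {a ℓ₁ b ℓ₂} (S : Setoid a ℓ₁) (T : Setoid b ℓ₂) (f : Func S T) →
  StrictlySurjective (Setoid._≈_ T) (Func.to f) →
  Σ[ s ∈ Func T S ] StrictlyInverseˡ (Setoid._≈_ T) (Func.to f) (Func.to s)

-- A cardinal is given by any setoid of that cardinality; only comparison of
-- cardinalities by injections is ever used.
infix 4 _≼_ _≺_

_≼_ : Setoid a ℓ → Setoid u v → Set (a ⊔ ℓ ⊔ u ⊔ v)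
S ≼ T = Injection S T

_≺_ : Setoid a ℓ → Setoid u v → Set (a ⊔ ℓ ⊔ u ⊔ v)
S ≺ T = S ≼ T × ¬ (T ≼ S)

Infinite : Setoid u v → Set (u ⊔ v)
Infinite L = setoid ℕ ≼ L

-- The elements of [ S ]^< L: subsets of S of cardinality less than L.  The
-- cardinality is that of the elements up to the equality of S.
record SmallSubset (S : Setoid a ℓ) (L : Setoid u v) : Set (suc (a ⊔ ℓ) ⊔ u ⊔ v) where
  open Setoid S
  field
    member   : Pred Carrier (a ⊔ ℓ)
    respects : member Respects _≈_

  asSetoid : Setoid (a ⊔ ℓ) ℓ
  asSetoid = On.setoid {B = Σ Carrier member} S proj₁

  field
    small : asSetoid ≺ L

open SmallSubset using (member)

[_]^<_ : Setoid a ℓ → Setoid u v → Setoid (suc (a ⊔ ℓ) ⊔ u ⊔ v) (a ⊔ ℓ)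
[ S ]^< L = record
  { Carrier       = SmallSubset S L
  ; _≈_           = λ A B → member A ≐ member B
  ; isEquivalence = record
    { refl  = id , id
    ; sym   = swap
    ; trans = λ (A⊆B , B⊆A) (B⊆C , C⊆B) → B⊆C ∘ A⊆B , B⊆A ∘ C⊆B
    }
  }

record HasFN (P : Poset a ℓ₁ ℓ₂) (L : Setoid u v) (K : Setoid u′ v′)
       : Set (suc (a ⊔ ℓ₁) ⊔ ℓ₂ ⊔ u ⊔ v ⊔ u′ ⊔ v′) where
  open Poset P
  field
    F : Func Eq.setoid ([ Eq.setoid ]^< L)
    G : Func Eq.setoid ([ Eq.setoid ]^< K)

  f : Carrier → Pred Carrier (a ⊔ ℓ₁)
  f p = member (Func.to F p)

  g : Carrier → Pred Carrier (a ⊔ ℓ₁)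
  g p = member (Func.to G p)

  field
    interpolate : ∀ {p q} → p ≤ q →
      (∃[ r ] (r ∈ f p × r ∈ g q × p ≤ r × r ≤ q)) ×
      (∃[ s ] (s ∈ g p × s ∈ f q × p ≤ s × s ≤ q))

BooleanAlgebraHasFN : BooleanAlgebra c ℓ → Setoid u v → Setoid u′ v′ →
                      Set (suc (c ⊔ ℓ) ⊔ u ⊔ v ⊔ u′ ⊔ v′)
BooleanAlgebraHasFN A = HasFN (BooleanAlgebraProperties.poset A)

record BooleanHomomorphism (A : BooleanAlgebra a ℓ₁) (B : BooleanAlgebra b ℓ₂)
       : Set (a ⊔ ℓ₁ ⊔ b ⊔ ℓ₂) where
  private
    module A = BooleanAlgebra A
    module B = BooleanAlgebra B
  field
    ⟦_⟧                   : A.Carrier → B.Carrier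
    isLatticeHomomorphism : IsLatticeHomomorphism A.rawLattice B.rawLattice ⟦_⟧
    ¬-homo                : ∀ x → ⟦ A.¬ x ⟧ B.≈ B.¬ ⟦ x ⟧
    ⊤-homo                : ⟦ A.⊤ ⟧ B.≈ B.⊤
    ⊥-homo                : ⟦ A.⊥ ⟧ B.≈ B.⊥

open BooleanHomomorphism using (⟦_⟧)

-- The universal property of ∐ᵢ Bᵢ in the category of boolean algebras
-- BooleanAlgebra c ℓ, for index sets in the same universe as the carriers.
record IsCoproduct {I : Set c} (Bᵢ : I → BooleanAlgebra c ℓ) (B : BooleanAlgebra c ℓ)
       : Set (suc (c ⊔ ℓ)) where
  field
    ι : ∀ i → BooleanHomomorphism (Bᵢ i) B

  Extends : (C : BooleanAlgebra c ℓ) → (∀ i → BooleanHomomorphism (Bᵢ i) C) →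
            BooleanHomomorphism B C → Set (c ⊔ ℓ)
  Extends C φ h = ∀ i x → BooleanAlgebra._≈_ C (⟦ h ⟧ (⟦ ι i ⟧ x)) (⟦ φ i ⟧ x)

  field
    mediate : ∀ C φ → Σ[ h ∈ BooleanHomomorphism B C ] Extends C φ h
    unique  : ∀ C φ h h′ → Extends C φ h → Extends C φ h′ →
              ∀ y → BooleanAlgebra._≈_ C (⟦ h ⟧ y) (⟦ h′ ⟧ y)

{-# OPTIONS --safe #-}
module Submission where

-- Write p as a finite join of finite meets of elements of the factors, and
-- likewise ¬ q.  If p ≤ q, then every clause m of p is disjoint from every
-- clause n of ¬ q.  By independence of the factors in a coproduct, this is
-- already witnessed in a single factor i: the coordinates satisfy mᵢ ≤ ¬ nᵢ,
-- and the FN maps of Bᵢ interpolate an element between m and ¬ n.  Joining over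
-- m the meets over n of these elements interpolates between p and q.  So one
-- takes for f(p) all finite joins of finite meets of elements of ιᵢ[fᵢ(mᵢ)] and
-- ιᵢ[fᵢ(¬ nᵢ)], where m and n run over the clauses of p and ¬ p, and similarly
-- for g.  These sets are small because X × X ≼ X for infinite X, while
-- finitely generated distributive lattices are finite.
-- Independence is proved by ultrafilters.

open import Defs
open import Level using (Level; 0ℓ; _⊔_; Lift; lift; lower)
open import Axiom.UniquenessOfIdentityProofs.WithK using (uip)
open import Algebra.Bundles using (IdempotentCommutativeMonoid)
open import Algebra.Lattice.Bundles using (BooleanAlgebra)
open import Algebra.Lattice.Morphism.Structures using (IsLatticeHomomorphism)
import Algebra.Lattice.Properties.BooleanAlgebra as BooleanAlgebraProperties
open import Data.Bool.Base using (Bool; true; false; T; not)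
import Data.Bool.Properties as Bool
open import Data.Empty as Empty using (⊥-elim)
open import Data.Fin.Base using (Fin)
import Data.Fin.Properties as Fin
open import Data.List.Base using (List; []; _∷_; _++_; map; concatMap; foldr; length; lookup)
open import Data.List.Properties using (map-∘)
open import Data.List.Membership.Propositional using (find; lose) renaming (_∈_ to _∈ₗ_)
open import Data.List.Membership.Propositional.Properties using (∈-map⁺; ∈-concatMap⁺)
open import Data.List.Relation.Unary.All as All using (All; []; _∷_)
import Data.List.Relation.Unary.All.Properties as All
open import Data.List.Relation.Unary.Any as Any using (Any; here; there)
import Data.List.Relation.Unary.Any.Properties as Any
open import Data.Nat.Base using (ℕ; zero; suc; _<_; _<′_; ≤′-refl; ≤′-step)
import Data.Nat.Properties as ℕ
open import Data.Nat.Binary.Base using (ℕᵇ; 2[1+_]; 1+[2_]; toℕ)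
open import Data.Nat.Binary.Properties using (toℕ-injective; 2[1+_]-injective; 1+[2_]-injective)
open import Data.Product.Base using (Σ; Σ-syntax; ∃; ∃-syntax; _×_; _,_; proj₁; proj₂)
open import Data.Product.Function.NonDependent.Propositional using (_×-↣_)
open import Data.Sum.Base as Sum using (_⊎_; inj₁; inj₂; [_,_]′)
open import Data.Sum.Function.Propositional using (_⊎-↣_)
open import Data.Sum.Properties using (inj₁-injective; inj₂-injective)
open import Function.Base using (id; _∘_)
open import Function.Bundles using (Func; Injection; Equivalence; _↣_; mk↣)
import Function.Construct.Composition as Composition
import Function.Construct.Identity as Identity
open import Relation.Binary.Bundles using (Setoid)
import Relation.Binary.Construct.On as On
import Relation.Binary.Lattice.Bundles as OrderLattice
import Relation.Binary.Reasoning.Setoid as SetoidReasoning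
open import Relation.Binary.Definitions using (tri<; tri≈; tri>)
open import Relation.Binary.PropositionalEquality
  using (_≡_; refl; sym; trans; cong; cong₂; subst; setoid; _→-setoid_)
open import Relation.Nullary.Decidable
  using (Dec; yes; no; ⌊_⌋; toWitness; fromWitness; decidable-stable)
open import Relation.Nullary.Negation using (¬_; contradiction)
open import Relation.Unary using (Pred; _≐_)

-- Injections and comparison of cardinals.

infixr 9 _⨾_

_⨾_ : ∀ {a b c ℓ₁ ℓ₂ ℓ₃} {S : Setoid a ℓ₁} {T : Setoid b ℓ₂} {U : Setoid c ℓ₃} →
      S ≼ T → T ≼ U → S ≼ U
_⨾_ = Composition.injection

-- m and n are the lengths of the two blocks of digits 1 in the binary
-- representation.
pairℕ : (ℕ × ℕ) ↣ ℕ
pairℕ = mk↣ {to = λ (m , n) → toℕ (ones m 2[1+ ones n ℕᵇ.zero ])} λ {p} {q} eq → ones-split p q (toℕ-injective eq)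
  where
  ones : ℕ → ℕᵇ → ℕᵇ
  ones zero    b = b
  ones (suc n) b = 1+[2 ones n b ]

  ones-injective : ∀ m n → ones m ℕᵇ.zero ≡ ones n ℕᵇ.zero → m ≡ n
  ones-injective zero    zero    _  = refl
  ones-injective (suc m) (suc n) eq = cong suc (ones-injective m n (1+[2_]-injective eq))

  ones-split : ∀ ((m , n) (m′ , n′) : ℕ × ℕ) →
               ones m 2[1+ ones n ℕᵇ.zero ] ≡ ones m′ 2[1+ ones n′ ℕᵇ.zero ] → (m , n) ≡ (m′ , n′)
  ones-split (zero  , n) (zero   , n′) eq = cong (0 ,_) (ones-injective n n′ (2[1+_]-injective eq))
  ones-split (suc m , n) (suc m′ , n′) eq =
    cong (λ (k , l) → suc k , l) (ones-split (m , n) (m′ , n′) (1+[2_]-injective eq))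

⊎-square : ∀ {a} {A : Set a} → ℕ ↣ A → (A × A) ↣ A → (A ⊎ A) ↣ A
⊎-square {A = A} e square = mk↣ {to = tag} (λ {x} {y} → tag-injective x y) ⨾ square
  where
  tag : A ⊎ A → A × A
  tag (inj₁ x) = Injection.to e 0 , x
  tag (inj₂ x) = Injection.to e 1 , x

  tag-injective : ∀ x y → tag x ≡ tag y → x ≡ y
  tag-injective (inj₁ _) (inj₁ _) eq = cong inj₁ (cong proj₂ eq)
  tag-injective (inj₂ _) (inj₂ _) eq = cong inj₂ (cong proj₂ eq)
  tag-injective (inj₁ _) (inj₂ _) eq = contradiction (Injection.injective e (cong proj₁ eq)) λ ()
  tag-injective (inj₂ _) (inj₁ _) eq = contradiction (Injection.injective e (cong proj₁ eq)) λ ()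

-- Lists are coded by nested pairs; the tag in front, the image of 0 or of 1 under `e`, tells
-- whether the list ends there.
List-square : ∀ {a} {A : Set a} → ℕ ↣ A → (A × A) ↣ A → List A ↣ A
List-square {A = A} e square = mk↣ {to = code} λ {xs} {ys} → code-injective xs ys
  where
  open Injection square using (to; injective)

  code : List A → A
  code []       = to (Injection.to e 0 , Injection.to e 0)
  code (x ∷ xs) = to (Injection.to e 1 , to (x , code xs))

  code-injective : ∀ xs ys → code xs ≡ code ys → xs ≡ ys
  code-injective []       []       eq = refl
  code-injective []       (_ ∷ _)  eq = contradiction (Injection.injective e (cong proj₁ (injective eq))) λ ()
  code-injective (_ ∷ _)  []       eq = contradiction (Injection.injective e (cong proj₁ (injective eq))) λ ()
  code-injective (x ∷ xs) (y ∷ ys) eq =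
    cong₂ _∷_ (cong proj₁ eq′) (code-injective xs ys (cong proj₂ eq′))
    where eq′ = injective (cong proj₂ (injective eq))

≼-≺-trans : ∀ {a b c ℓ₁ ℓ₂ ℓ₃} {S : Setoid a ℓ₁} {T : Setoid b ℓ₂} {U : Setoid c ℓ₃} →
            S ≼ T → T ≺ U → S ≺ U
≼-≺-trans S≼T (T≼U , U⋠T) = S≼T ⨾ T≼U , λ U≼S → U⋠T (U≼S ⨾ S≼T)

Fin-≺ : ∀ {u v} {L : Setoid u v} → Infinite L → ∀ n → setoid (Fin n) ≺ L
Fin-≺ inf n = mk↣ Fin.toℕ-injective ⨾ inf ,
  λ L≼Fin → Fin.ℕ→Fin-notInjective _ (Injection.injective (inf ⨾ L≼Fin))

-- Subsets as setoids, and finite products of their elements.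

⟨_∣_⟩ : ∀ {a ℓ p} (S : Setoid a ℓ) → Pred (Setoid.Carrier S) p → Setoid (a ⊔ p) ℓ
⟨ S ∣ X ⟩ = On.setoid {B = ∃ X} S proj₁

⊆-≼ : ∀ {a ℓ p q} (S : Setoid a ℓ) {X : Pred (Setoid.Carrier S) p} {Y : Pred (Setoid.Carrier S) q} →
      (∀ x → X x → Y x) → ⟨ S ∣ X ⟩ ≼ ⟨ S ∣ Y ⟩
⊆-≼ S X⊆Y = record { to = λ (x , x∈X) → x , X⊆Y x x∈X ; cong = id ; injective = id }

-- Idempotence bounds the products of a finite list of elements by the products
-- of its sublists.
module Products {c ℓ} (M : IdempotentCommutativeMonoid c ℓ) where
  open IdempotentCommutativeMonoid M
    renaming (refl to ≈-refl; sym to ≈-sym; trans to ≈-trans; setoid to M-setoid; _∙_ to _·_)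

  product : List Carrier → Carrier
  product = foldr _·_ ε

  Products : ∀ {p} → Pred Carrier p → Pred Carrier (c ⊔ ℓ ⊔ p)
  Products X y = Σ[ ws ∈ List (∃ X) ] y ≈ product (map proj₁ ws)

  Products-mono : ∀ {p q} {X : Pred Carrier p} {Y : Pred Carrier q} → (∀ {x} → X x → Y x) →
                  ∀ {y} → Products X y → Products Y y
  Products-mono X⊆Y {y} (ws , y≈) =
    map (λ (x , x∈X) → x , X⊆Y x∈X) ws , subst (λ xs → y ≈ product xs) (map-∘ ws) y≈

  subproducts : List Carrier → List Carrier
  subproducts []       = ε ∷ []
  subproducts (x ∷ xs) = subproducts xs ++ map (x ·_) (subproducts xs)

  ·-subproducts : ∀ {w z} xs → Any (w ≈_) xs → Any (z ≈_) (subproducts xs) →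
                  Any ((w · z) ≈_) (subproducts xs)
  ·-subproducts (x ∷ xs) (here w≈x) z∈ with Any.++⁻ (subproducts xs) z∈
  ... | inj₁ z∈ˡ = Any.++⁺ʳ (subproducts xs) (Any.map⁺ (Any.map (∙-cong w≈x) z∈ˡ))
  -- Here `z` already contains the factor `x`, and idempotence absorbs the second copy.
  ... | inj₂ z∈ʳ = Any.++⁺ʳ (subproducts xs) (Any.map⁺ (Any.map
    (λ z≈x·z′ → ≈-trans (∙-cong w≈x z≈x·z′) (≈-trans (≈-sym (assoc _ _ _)) (∙-congʳ (idem x))))
    (Any.map⁻ z∈ʳ)))
  ·-subproducts {w} (x ∷ xs) (there w∈) z∈ with Any.++⁻ (subproducts xs) z∈
  ... | inj₁ z∈ˡ = Any.++⁺ˡ (·-subproducts xs w∈ z∈ˡ)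
  ... | inj₂ z∈ʳ with find (Any.map⁻ z∈ʳ)
  ...   | z′ , z′∈ , z≈x·z′ = Any.++⁺ʳ (subproducts xs) (Any.map⁺ (Any.map
    (λ w·z′≈ → ≈-trans (≈-trans (∙-congˡ z≈x·z′) (swap-left w x z′)) (∙-congˡ w·z′≈))
    (·-subproducts xs w∈ (lose z′∈ ≈-refl))))
    where
    swap-left : ∀ a b c → (a · (b · c)) ≈ (b · (a · c))
    swap-left a b c = ≈-trans (≈-sym (assoc a b c)) (≈-trans (∙-congʳ (comm a b)) (assoc b a c))

  product-∈ : ∀ xs ws → All (λ w → Any (w ≈_) xs) ws → Any (product ws ≈_) (subproducts xs)
  product-∈ xs       (w ∷ ws) (w∈ ∷ ws∈) = ·-subproducts xs w∈ (product-∈ xs ws ws∈)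
  product-∈ []       []       []         = here ≈-refl
  product-∈ (x ∷ xs) []       []         = Any.++⁺ˡ (product-∈ xs [] [])

-- Order and homomorphisms of boolean algebras.

module BooleanOrder {c ℓ} (A : BooleanAlgebra c ℓ) where
  open BooleanAlgebra A public renaming
    (¬_ to infix 8 ∁_; ¬-cong to ∁-cong; refl to ≈-refl; sym to ≈-sym; trans to ≈-trans; setoid to ≈-setoid)
  open BooleanAlgebraProperties A public
    hiding (poset)
    renaming (¬-involutive to ∁-involutive; ¬⊥≈⊤ to ∁⊥≈⊤; ¬⊤≈⊥ to ∁⊤≈⊥)
  open OrderLattice.Lattice ∨-∧-orderTheoreticLattice public
    using (_≤_; x∧y≤x; x∧y≤y; ∧-greatest; x≤x∨y; y≤x∨y; ∨-least)
    renaming (refl to ≤-refl; reflexive to ≤-reflexive; trans to ≤-trans)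

  -- The order unfolds to `x ≈ x ∧ y`, so equational proofs serve directly as proofs of
  -- inequalities.
  ≤⊤ : ∀ x → x ≤ ⊤
  ≤⊤ x = ≈-sym (∧-identityʳ x)

  ⊥≤ : ∀ x → ⊥ ≤ x
  ⊥≤ x = ≈-sym (∧-zeroˡ x)

  ≤-respˡ : ∀ {x y z} → x ≈ y → x ≤ z → y ≤ z
  ≤-respˡ x≈y = ≤-trans (≤-reflexive (≈-sym x≈y))

  ≤-respʳ : ∀ {x y z} → x ≈ y → z ≤ x → z ≤ y
  ≤-respʳ x≈y z≤x = ≤-trans z≤x (≤-reflexive x≈y)

  ≤⊥⇒≈⊥ : ∀ {x} → x ≤ ⊥ → x ≈ ⊥
  ≤⊥⇒≈⊥ x≤⊥ = ≈-trans x≤⊥ (∧-zeroʳ _)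

  disjoint⇒≤∁ : ∀ {x y} → x ∧ y ≈ ⊥ → x ≤ ∁ y
  disjoint⇒≤∁ {x} {y} x∧y≈⊥ = begin
    x                 ≈⟨ ∧-identityʳ x ⟨
    x ∧ ⊤             ≈⟨ ∧-congˡ (∨-complementʳ y) ⟨
    x ∧ (y ∨ ∁ y)     ≈⟨ ∧-distribˡ-∨ x y (∁ y) ⟩
    x ∧ y ∨ x ∧ ∁ y   ≈⟨ ∨-congʳ x∧y≈⊥ ⟩
    ⊥ ∨ x ∧ ∁ y       ≈⟨ ∨-identityˡ _ ⟩
    x ∧ ∁ y           ∎
    where open SetoidReasoning ≈-setoid

  ≤∁⇒disjoint : ∀ {x y} → x ≤ ∁ y → x ∧ y ≈ ⊥
  ≤∁⇒disjoint {x} {y} x≤∁y = begin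
    x ∧ y           ≈⟨ ∧-congʳ x≤∁y ⟩
    (x ∧ ∁ y) ∧ y   ≈⟨ ∧-assoc x (∁ y) y ⟩
    x ∧ (∁ y ∧ y)   ≈⟨ ∧-congˡ (∧-complementˡ y) ⟩
    x ∧ ⊥           ≈⟨ ∧-zeroʳ x ⟩
    ⊥               ∎
    where open SetoidReasoning ≈-setoid

  ∁-antitone : ∀ {x y} → x ≤ y → ∁ y ≤ ∁ x
  ∁-antitone {x} {y} x≤y =
    disjoint⇒≤∁ (≈-trans (∧-comm _ _) (≤∁⇒disjoint (≤-respʳ (≈-sym (∁-involutive y)) x≤y)))

  ∧-idempotentCommutativeMonoid ∨-idempotentCommutativeMonoid : IdempotentCommutativeMonoid c ℓ
  ∧-idempotentCommutativeMonoid = record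
    { isIdempotentCommutativeMonoid = record { isCommutativeMonoid = ∧-⊤-isCommutativeMonoid ; idem = ∧-idem } }
  ∨-idempotentCommutativeMonoid = record
    { isIdempotentCommutativeMonoid = record { isCommutativeMonoid = ∨-⊥-isCommutativeMonoid ; idem = ∨-idem } }

module Homomorphism {a b ℓ₁ ℓ₂} {A : BooleanAlgebra a ℓ₁} {B : BooleanAlgebra b ℓ₂}
  (h : BooleanHomomorphism A B)
  where
  private
    module A = BooleanOrder A
    module B = BooleanOrder B
  open BooleanHomomorphism h public
  open IsLatticeHomomorphism isLatticeHomomorphism public

  ⟦⟧-mono : ∀ {x y} → x A.≤ y → ⟦ x ⟧ B.≤ ⟦ y ⟧
  ⟦⟧-mono x≤y = B.≈-trans (⟦⟧-cong x≤y) (∧-homo _ _)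

module _ {a b ℓ₁ ℓ₂} {A : BooleanAlgebra a ℓ₁} {B : BooleanAlgebra b ℓ₂} where
  private
    module A = BooleanOrder A
    module B = BooleanOrder B

  -- Meets and complements determine the remaining structure: joins by De Morgan, `⊥` as the meet of
  -- `⊤` and its complement, and `⊤` as the complement of `⊥`.
  ∧-∁-homomorphism : (f : A.Carrier → B.Carrier) →
    (∀ {x y} → x A.≈ y → f x B.≈ f y) → (∀ x y → f (x A.∧ y) B.≈ f x B.∧ f y) →
    (∀ x → f (A.∁ x) B.≈ B.∁ f x) → BooleanHomomorphism A B
  ∧-∁-homomorphism f f-cong f-∧ f-∁ = record
    { ⟦_⟧                   = f
    ; isLatticeHomomorphism = record
      { isRelHomomorphism = record { cong = f-cong }
      ; ∧-homo            = f-∧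
      ; ∨-homo            = f-∨
      }
    ; ¬-homo                = f-∁
    ; ⊤-homo                = f-⊤
    ; ⊥-homo                = f-⊥
    }
    where
    open SetoidReasoning B.≈-setoid

    f-∨ : ∀ x y → f (x A.∨ y) B.≈ f x B.∨ f y
    f-∨ x y = begin
      f (x A.∨ y)                       ≈⟨ f-cong (A.∁-involutive _) ⟨
      f (A.∁ A.∁ (x A.∨ y))             ≈⟨ f-∁ _ ⟩
      B.∁ f (A.∁ (x A.∨ y))             ≈⟨ B.∁-cong (f-cong (A.deMorgan₂ x y)) ⟩
      B.∁ f (A.∁ x A.∧ A.∁ y)           ≈⟨ B.∁-cong (f-∧ _ _) ⟩
      B.∁ (f (A.∁ x) B.∧ f (A.∁ y))     ≈⟨ B.∁-cong (B.∧-cong (f-∁ x) (f-∁ y)) ⟩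
      B.∁ (B.∁ f x B.∧ B.∁ f y)         ≈⟨ B.∁-cong (B.deMorgan₂ _ _) ⟨
      B.∁ B.∁ (f x B.∨ f y)             ≈⟨ B.∁-involutive _ ⟩
      f x B.∨ f y                       ∎

    f-⊥ : f A.⊥ B.≈ B.⊥
    f-⊥ = begin
      f A.⊥                       ≈⟨ f-cong (A.∧-complementʳ A.⊤) ⟨
      f (A.⊤ A.∧ A.∁ A.⊤)         ≈⟨ f-∧ _ _ ⟩
      f A.⊤ B.∧ f (A.∁ A.⊤)       ≈⟨ B.∧-congˡ (f-∁ _) ⟩
      f A.⊤ B.∧ B.∁ f A.⊤         ≈⟨ B.∧-complementʳ _ ⟩
      B.⊥                         ∎

    f-⊤ : f A.⊤ B.≈ B.⊤
    f-⊤ = begin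
      f A.⊤           ≈⟨ f-cong A.∁⊥≈⊤ ⟨
      f (A.∁ A.⊥)     ≈⟨ f-∁ _ ⟩
      B.∁ f A.⊥       ≈⟨ B.∁-cong f-⊥ ⟩
      B.∁ B.⊥         ≈⟨ B.∁⊥≈⊤ ⟩
      B.⊤             ∎

identity : ∀ {a ℓ} (A : BooleanAlgebra a ℓ) → BooleanHomomorphism A A
identity A = ∧-∁-homomorphism id id (λ _ _ → ≈-refl) (λ _ → ≈-refl)
  where open BooleanOrder A

_∘ₕ_ : ∀ {a b c ℓ₁ ℓ₂ ℓ₃} {A : BooleanAlgebra a ℓ₁} {B : BooleanAlgebra b ℓ₂} {C : BooleanAlgebra c ℓ₃} →
       BooleanHomomorphism B C → BooleanHomomorphism A B → BooleanHomomorphism A C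
_∘ₕ_ {C = C} g f = ∧-∁-homomorphism (G.⟦_⟧ ∘ F.⟦_⟧) (G.⟦⟧-cong ∘ F.⟦⟧-cong)
  (λ x y → ≈-trans (G.⟦⟧-cong (F.∧-homo x y)) (G.∧-homo _ _))
  (λ x → ≈-trans (G.⟦⟧-cong (F.¬-homo x)) (G.¬-homo _))
  where
  open BooleanOrder C using (≈-trans)
  module F = Homomorphism f
  module G = Homomorphism g

-- Terms and generated subalgebras.

data Term {v} (V : Set v) : Set v where
  var         : V → Term V
  _∧ₜ_ _∨ₜ_   : Term V → Term V → Term V
  ∁ₜ_         : Term V → Term V
  ⊤ₜ ⊥ₜ       : Term V

-- Terms that are equal when their value in A is: the subalgebra of A generated
-- by the values of the variables, with a carrier in the universe of V.
module Generated {a v ℓ₁} (ℓ₂ : Level) (A : BooleanAlgebra a ℓ₁) {V : Set v}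
  (value : V → BooleanAlgebra.Carrier A)
  where
  open BooleanOrder A

  eval : Term V → Carrier
  eval (var x)  = value x
  eval (s ∧ₜ t) = eval s ∧ eval t
  eval (s ∨ₜ t) = eval s ∨ eval t
  eval (∁ₜ t)   = ∁ eval t
  eval ⊤ₜ       = ⊤
  eval ⊥ₜ       = ⊥

  generated : BooleanAlgebra v (ℓ₁ ⊔ ℓ₂)
  generated = record
    { Carrier          = Term V
    ; _≈_              = λ s t → Lift ℓ₂ (eval s ≈ eval t)
    ; _∨_              = _∨ₜ_
    ; _∧_              = _∧ₜ_
    ; ¬_               = ∁ₜ_
    ; ⊤                = ⊤ₜ
    ; ⊥                = ⊥ₜ
    ; isBooleanAlgebra = record
      { isDistributiveLattice = record
        { isLattice = record
          { isEquivalence = record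
            { refl  = lift ≈-refl
            ; sym   = λ (lift e) → lift (≈-sym e)
            ; trans = λ (lift e) (lift f) → lift (≈-trans e f)
            }
          ; ∨-comm     = λ _ _ → lift (∨-comm _ _)
          ; ∨-assoc    = λ _ _ _ → lift (∨-assoc _ _ _)
          ; ∨-cong     = λ (lift e) (lift f) → lift (∨-cong e f)
          ; ∧-comm     = λ _ _ → lift (∧-comm _ _)
          ; ∧-assoc    = λ _ _ _ → lift (∧-assoc _ _ _)
          ; ∧-cong     = λ (lift e) (lift f) → lift (∧-cong e f)
          ; absorptive = (λ _ _ → lift (∨-absorbs-∧ _ _)) , (λ _ _ → lift (∧-absorbs-∨ _ _))
          }
        ; ∨-distrib-∧ = (λ _ _ _ → lift (∨-distribˡ-∧ _ _ _)) , (λ _ _ _ → lift (∨-distribʳ-∧ _ _ _))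
        ; ∧-distrib-∨ = (λ _ _ _ → lift (∧-distribˡ-∨ _ _ _)) , (λ _ _ _ → lift (∧-distribʳ-∨ _ _ _))
        }
      ; ∨-complement = (λ _ → lift (∨-complementˡ _)) , (λ _ → lift (∨-complementʳ _))
      ; ∧-complement = (λ _ → lift (∧-complementˡ _)) , (λ _ → lift (∧-complementʳ _))
      ; ¬-cong       = λ (lift e) → lift (∁-cong e)
      }
    }

  evaluation : BooleanHomomorphism generated A
  evaluation = ∧-∁-homomorphism eval lower (λ _ _ → ≈-refl) (λ _ → ≈-refl)

  -- Supplies the maps from the factors into a generated algebra, to which the universal property of
  -- the coproduct is then applied.
  corestrict : ∀ {d ℓ₃} {D : BooleanAlgebra d ℓ₃} (f : BooleanHomomorphism D A)
    (g : BooleanAlgebra.Carrier D → V) → (∀ x → value (g x) ≈ BooleanHomomorphism.⟦_⟧ f x) →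
    BooleanHomomorphism D generated
  corestrict f g g-f = ∧-∁-homomorphism (var ∘ g)
    (λ {x} {y} x≈y → lift (≈-trans (g-f x) (≈-trans (⟦⟧-cong x≈y) (≈-sym (g-f y)))))
    (λ x y → lift (≈-trans (g-f _) (≈-trans (∧-homo x y) (∧-cong (≈-sym (g-f x)) (≈-sym (g-f y))))))
    (λ x → lift (≈-trans (g-f _) (≈-trans (¬-homo x) (∁-cong (≈-sym (g-f x))))))
    where open Homomorphism f using (⟦⟧-cong; ∧-homo; ¬-homo)

-- Excluded middle and canonical representatives.

module _ (ac : AxiomOfChoice) where

  -- Diaconescu's argument: `P` identifies `true` and `false` in the quotient. A section with
  -- distinct values refutes `P`; one with equal values must have used `P` to identify them.
  lem : ∀ {p} (P : Set p) → Dec P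
  lem {p} P with ac (setoid Bool) quotient (record { to = id ; cong = inj₁ }) (λ y → y , inj₁ refl)
    where
    quotient : Setoid 0ℓ p
    quotient = record
      { Carrier       = Bool
      ; _≈_           = λ x y → x ≡ y ⊎ P
      ; isEquivalence = record
        { refl  = inj₁ refl
        ; sym   = Sum.map₁ sym
        ; trans = λ { (inj₁ refl) y≈z → y≈z ; (inj₂ p) _ → inj₂ p }
        }
      }
  ... | s , s-section with Func.to s true Bool.≟ Func.to s false
  ...   | no  s≢ = no λ p → s≢ (Func.cong s (inj₂ p))
  ...   | yes s≡ with s-section true | s-section false
  ...     | inj₂ p | _      = yes p
  ...     | inj₁ _ | inj₂ p = yes p
  ...     | inj₁ t | inj₁ f = contradiction (trans (sym t) (trans s≡ f)) λ ()

  -- Choice is applied to the identity map from propositional equality onto `S`. Equal elements get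
  -- identical representatives, so that any construction made at representatives respects `≈`.
  module Canonical {a ℓ} (S : Setoid a ℓ) where
    open Setoid S using (Carrier; _≈_)

    private
      section = ac (setoid Carrier) S
        (record { to = id ; cong = λ { refl → Setoid.refl S } }) (λ y → y , Setoid.refl S)

    rep : Carrier → Carrier
    rep = Func.to (proj₁ section)

    rep-≈ : ∀ x → rep x ≈ x
    rep-≈ = proj₂ section

    rep-cong : ∀ {x y} → x ≈ y → rep x ≡ rep y
    rep-cong = Func.cong (proj₁ section)

  -- Zorn's lemma.

  Subset : ∀ {u} → Set u → Set u
  Subset U = U → Bool

  -- Excluded middle decides every predicate, which makes the power set
  -- impredicative: families of subsets of any size have a union in Subset U.
  ⟪_⟫ : ∀ {u p} {U : Set u} → (U → Set p) → Subset U
  ⟪ P ⟫ x = ⌊ lem (P x) ⌋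

  infix 4 _∈_ _⊆_

  _∈_ : ∀ {u} {U : Set u} → U → Subset U → Set
  x ∈ S = T (S x)

  _⊆_ : ∀ {u} {U : Set u} → Subset U → Subset U → Set u
  S ⊆ S′ = ∀ x → x ∈ S → x ∈ S′

  T-ext : ∀ {x y} → (T x → T y) → (T y → T x) → x ≡ y
  T-ext {false} {false} _ _ = refl
  T-ext {false} {true}  _ g = ⊥-elim (g _)
  T-ext {true}  {false} f _ = ⊥-elim (f _)
  T-ext {true}  {true}  _ _ = refl

  -- Goodness is a condition on pairs of elements that persists when the set grows. Hence the union
  -- of a chain of good sets is good: two of its elements lie in a common member.
  module Zorn {u ℓ} {U : Set u} (Φ : Subset U → U → U → Set ℓ)
    (Φ-mono : ∀ {S S′ t t′} → S ⊆ S′ → Φ S t t′ → Φ S′ t t′)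
    where

    Good : Subset U → Set (u ⊔ ℓ)
    Good S = ∀ t t′ → t ∈ S → t′ ∈ S → Φ S t t′

    Extension : Subset U → Set (u ⊔ ℓ)
    Extension S = ∃[ S′ ] (Good S′ × S ⊆ S′ × ¬ (S′ ⊆ S))

    extend : ∀ S → Dec (Extension S) → Subset U
    extend S (yes (S′ , _)) = S′
    extend S (no _)         = S

    extend-⊇ : ∀ S d → S ⊆ extend S d
    extend-⊇ S (yes (_ , _ , S⊆S′ , _)) = S⊆S′
    extend-⊇ S (no _)                   = λ _ → id

    extend-good : ∀ S d → Good S → Good (extend S d)
    extend-good S (yes (_ , good , _)) _    = good
    extend-good S (no _)               good = good

    extend-maximal : ∀ S d → extend S d ⊆ S → ∀ {S′} → Good S′ → S ⊆ S′ → S′ ⊆ S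
    extend-maximal S (yes (_ , _ , _ , S′⊈S)) S′⊆S = contradiction S′⊆S S′⊈S
    extend-maximal S (no ¬ext) _ good S⊆S′ =
      decidable-stable (lem _) λ S′⊈S → ¬ext (_ , good , S⊆S′ , S′⊈S)

    open Canonical (U →-setoid Bool)

    ⊆-rep : ∀ S → S ⊆ rep S
    ⊆-rep S x = subst T (sym (rep-≈ S x))

    rep-⊆ : ∀ S → rep S ⊆ S
    rep-⊆ S x = subst T (rep-≈ S x)

    -- Extending the representative makes sets with the same elements have the same successor; the
    -- extension itself is picked for a function into `Bool`, not for its extension.
    next : Subset U → Subset U
    next S = extend (rep S) (lem _)

    next-⊇ : ∀ S → S ⊆ next S
    next-⊇ S x = extend-⊇ (rep S) (lem _) x ∘ ⊆-rep S x

    next-good : ∀ S → Good S → Good (next S)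
    next-good S good = extend-good (rep S) (lem _)
      λ t t′ t∈ t′∈ → Φ-mono (⊆-rep S) (good t t′ (rep-⊆ S t t∈) (rep-⊆ S t′ t′∈))

    next-cong : ∀ {S S′} → S ⊆ S′ → S′ ⊆ S → next S ⊆ next S′
    next-cong S⊆S′ S′⊆S x =
      subst (λ R → x ∈ extend R (lem _)) (rep-cong λ y → T-ext (S⊆S′ y) (S′⊆S y))

    module Above (S₀ : Subset U) (good₀ : Good S₀) where

      -- Adding `S₀` makes the union of the empty family the bottom of the tower.
      ⋃ : Subset (Subset U) → Subset U
      ⋃ P = ⟪ (λ t → t ∈ S₀ ⊎ ∃[ S ] (S ∈ P × t ∈ S)) ⟫

      ⊆-⋃ : ∀ {S} P → S ∈ P → S ⊆ ⋃ P
      ⊆-⋃ P S∈P x x∈S = fromWitness (inj₂ (_ , S∈P , x∈S))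

      -- The tower of the Bourbaki-Witt argument, which is a chain and takes the place of a
      -- transfinite recursion.
      data Tower : Subset U → Set u where
        step : ∀ {S} → Tower S → Tower (next S)
        join : ∀ P → (∀ S → S ∈ P → Tower S) → Tower (⋃ P)

      tower-⊇ : ∀ {S} → Tower S → S₀ ⊆ S
      tower-⊇ (step {S} tS) x = next-⊇ S x ∘ tower-⊇ tS x
      tower-⊇ (join P _) x x∈S₀ = fromWitness (inj₁ x∈S₀)

      ⋃-least : ∀ P {c} → Tower c → ¬ (∃[ S ] (S ∈ P × ¬ (S ⊆ c))) → ⋃ P ⊆ c
      ⋃-least P tc none x x∈⋃ with toWitness x∈⋃
      ... | inj₁ x∈S₀           = tower-⊇ tc x x∈S₀
      ... | inj₂ (S , S∈P , x∈S) =
        decidable-stable (lem _) (λ S⊈c → none (S , S∈P , S⊈c)) x x∈S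

      Extreme : Subset U → Set u
      Extreme c = ∀ {x} → Tower x → x ⊆ c → c ⊆ x ⊎ next x ⊆ c

      -- Induction on the tower element `x`. At a union, either every member lies in `c`, or a
      -- member that does not is already above `next c`.
      compare : ∀ {c} → Tower c → Extreme c → ∀ {x} → Tower x → x ⊆ c ⊎ next c ⊆ x
      compare tc ext (step {x} tx) with compare tc ext tx
      ... | inj₂ nc⊆x = inj₂ λ y → next-⊇ x y ∘ nc⊆x y
      ... | inj₁ x⊆c with ext tx x⊆c
      ...   | inj₁ c⊆x  = inj₂ (next-cong c⊆x x⊆c)
      ...   | inj₂ nx⊆c = inj₁ nx⊆c
      compare {c} tc ext (join P tP) with lem (∃[ S ] (S ∈ P × ¬ (S ⊆ c)))
      ... | no none = inj₁ (⋃-least P tc none)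
      ... | yes (S , S∈P , S⊈c) with compare tc ext (tP S S∈P)
      ...   | inj₁ S⊆c  = contradiction S⊆c S⊈c
      ...   | inj₂ nc⊆S = inj₂ λ y → ⊆-⋃ P S∈P y ∘ nc⊆S y

      -- At a union that does not lie in `x`, some member `S` is not contained in `x`. Then
      -- `compare` puts `x` inside `S`, and extremeness of `S` puts `next x` there too.
      extreme : ∀ {c} → Tower c → Extreme c
      extreme (step {c} tc) tx x⊆nc with compare tc (extreme tc) tx
      ... | inj₂ nc⊆x = inj₁ nc⊆x
      ... | inj₁ x⊆c with extreme tc tx x⊆c
      ...   | inj₁ c⊆x  = inj₂ (next-cong x⊆c c⊆x)
      ...   | inj₂ nx⊆c = inj₂ λ y → next-⊇ c y ∘ nx⊆c y
      extreme (join P tP) {x} tx x⊆⋃ with lem (∃[ S ] (S ∈ P × ¬ (S ⊆ x)))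
      ... | no none = inj₁ (⋃-least P tx none)
      ... | yes (S , S∈P , S⊈x) with compare (tP S S∈P) (extreme (tP S S∈P)) tx
      ...   | inj₂ nS⊆x = contradiction (λ y → nS⊆x y ∘ next-⊇ S y) S⊈x
      ...   | inj₁ x⊆S with extreme (tP S S∈P) tx x⊆S
      ...     | inj₁ S⊆x  = contradiction S⊆x S⊈x
      ...     | inj₂ nx⊆S = inj₂ λ y → ⊆-⋃ P S∈P y ∘ nx⊆S y

      total : ∀ {x y} → Tower x → Tower y → x ⊆ y ⊎ y ⊆ x
      total {x} {y} tx ty with compare ty (extreme ty) tx
      ... | inj₁ x⊆y  = inj₁ x⊆y
      ... | inj₂ ny⊆x = inj₂ λ z → ny⊆x z ∘ next-⊇ y z

      tower-good : ∀ {S} → Tower S → Good S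
      tower-good (step {S} tS) = next-good S (tower-good tS)
      tower-good (join P tP) t t′ t∈ t′∈ with toWitness t∈ | toWitness t′∈
      ... | inj₁ t∈S₀ | inj₁ t′∈S₀ = Φ-mono (tower-⊇ (join P tP)) (good₀ t t′ t∈S₀ t′∈S₀)
      ... | inj₁ t∈S₀ | inj₂ (S , S∈P , t′∈S) =
        Φ-mono (⊆-⋃ P S∈P) (tower-good (tP S S∈P) t t′ (tower-⊇ (tP S S∈P) t t∈S₀) t′∈S)
      ... | inj₂ (S , S∈P , t∈S) | inj₁ t′∈S₀ =
        Φ-mono (⊆-⋃ P S∈P) (tower-good (tP S S∈P) t t′ t∈S (tower-⊇ (tP S S∈P) t′ t′∈S₀))
      ... | inj₂ (S , S∈P , t∈S) | inj₂ (S′ , S′∈P , t′∈S′) with total (tP S S∈P) (tP S′ S′∈P)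
      ...   | inj₁ S⊆S′ =
        Φ-mono (⊆-⋃ P S′∈P) (tower-good (tP S′ S′∈P) t t′ (S⊆S′ t t∈S) t′∈S′)
      ...   | inj₂ S′⊆S =
        Φ-mono (⊆-⋃ P S∈P) (tower-good (tP S S∈P) t t′ t∈S (S′⊆S t′ t′∈S′))

      zorn : ∃[ M ] (S₀ ⊆ M × Good M × (∀ {S} → Good S → M ⊆ S → S ⊆ M))
      zorn = M , tower-⊇ tM , tower-good tM , maximal
        where
        M = ⋃ ⟪ Tower ⟫

        -- By impredicativity the union of the whole tower belongs to the tower. Its successor then
        -- adds nothing, so it has no proper good extension.
        tM : Tower M
        tM = join ⟪ Tower ⟫ λ _ → toWitness

        nM⊆M : next M ⊆ M
        nM⊆M = ⊆-⋃ ⟪ Tower ⟫ (fromWitness (step tM))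

        maximal : ∀ {S} → Good S → M ⊆ S → S ⊆ M
        maximal good M⊆S x = rep-⊆ M x ∘
          extend-maximal (rep M) (lem _) (λ y → ⊆-rep M y ∘ nM⊆M y) good
            (λ y → M⊆S y ∘ rep-⊆ M y) x

  -- Comparability of cardinals and Hessenberg's theorem.

  -- Zorn's lemma gives a maximal partial injection from `A` to `B`. If it missed both a point `a`
  -- of `A` and a point `b` of `B`, the pair `(a , b)` could be added.
  comparable : ∀ {a b} (A : Set a) (B : Set b) → A ↣ B ⊎ B ↣ A
  comparable A B with zorn
    where
    open Zorn {U = A × B}
      (λ _ t t′ → (proj₁ t ≡ proj₁ t′ → proj₂ t ≡ proj₂ t′) × (proj₂ t ≡ proj₂ t′ → proj₁ t ≡ proj₁ t′))
      (λ _ → id)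
    open Above (λ _ → false) (λ _ _ ())
  ... | M , _ , good , maximal
    with lem (∃[ a ] ∀ b → ¬ ((a , b) ∈ M)) | lem (∃[ b ] ∀ a → ¬ ((a , b) ∈ M))
  ...   | no ¬a | _ = inj₁ (mk↣ {to = proj₁ ∘ partner} λ eq →
          proj₂ (good _ _ (proj₂ (partner _)) (proj₂ (partner _))) eq)
    where
    partner : ∀ a → ∃[ b ] ((a , b) ∈ M)
    partner a = decidable-stable (lem _) λ ∄b → ¬a (a , λ b ∈M → ∄b (b , ∈M))
  ...   | yes _ | no ¬b = inj₂ (mk↣ {to = proj₁ ∘ partner} λ eq →
          proj₁ (good _ _ (proj₂ (partner _)) (proj₂ (partner _))) eq)
    where
    partner : ∀ b → ∃[ a ] ((a , b) ∈ M)
    partner b = decidable-stable (lem _) λ ∄a → ¬b (b , λ a ∈M → ∄a (a , ∈M))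
  ...   | yes (a , a∉) | yes (b , b∉) = contradiction
          (maximal {⟪ M⁺ ⟫} good⁺ (λ t → fromWitness ∘ inj₁) (a , b) (fromWitness (inj₂ refl))) (a∉ b)
    where
    M⁺ : A × B → Set _
    M⁺ t = t ∈ M ⊎ t ≡ (a , b)

    good⁺ : ∀ t t′ → t ∈ ⟪ M⁺ ⟫ → t′ ∈ ⟪ M⁺ ⟫ → _
    good⁺ t t′ t∈ t′∈ with toWitness t∈ | toWitness t′∈
    ... | inj₁ t∈M  | inj₁ t′∈M = good t t′ t∈M t′∈M
    ... | inj₁ t∈M  | inj₂ refl = (λ { refl → ⊥-elim (a∉ _ t∈M) }) , (λ { refl → ⊥-elim (b∉ _ t∈M) })
    ... | inj₂ refl | inj₁ t∈M  = (λ { refl → ⊥-elim (a∉ _ t∈M) }) , (λ { refl → ⊥-elim (b∉ _ t∈M) })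
    ... | inj₂ refl | inj₂ refl = (λ _ → refl) , (λ _ → refl)

  -- A maximal injection `D × D → D` extending the pairing on the copy of ℕ is compared with the
  -- complement `E` of `D`. If `E` embeds into `D`, then so does `A`, through `D ⊎ D`; if `D` embeds
  -- into `E`, the injection was not maximal.
  module Hessenberg {a} (A : Set a) (e : ℕ ↣ A) where

    Domain : Subset ((A × A) × A) → A → Set a
    Domain S x = ∃[ y ] ∃[ z ] (((x , y) , z) ∈ S)

    -- A set S of triples all pairs of which satisfy Φ S is the graph of an
    -- injection D × D → D, where D = Domain S.
    Φ : Subset ((A × A) × A) → (A × A) × A → (A × A) × A → Set a
    Φ S ((x , y) , z) ((x′ , y′) , z′) =
      ((x , y) ≡ (x′ , y′) → z ≡ z′) × (z ≡ z′ → (x , y) ≡ (x′ , y′)) ×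
      (∃[ w ] (((x , x′) , w) ∈ S)) × Domain S y × Domain S z

    Φ-mono : ∀ {S S′ t t′} → S ⊆ S′ → Φ S t t′ → Φ S′ t t′
    Φ-mono S⊆S′ (functional , injective , (_ , xx′∈) , (_ , _ , y∈) , (_ , _ , z∈)) =
      functional , injective , (_ , S⊆S′ _ xx′∈) , (_ , _ , S⊆S′ _ y∈) , (_ , _ , S⊆S′ _ z∈)

    open Zorn Φ (λ {S} {S′} {t} {t′} → Φ-mono {S} {S′} {t} {t′})

    -- Transports a pairing of `W` into `A`. It serves twice: with `W = ℕ` for the starting point,
    -- and with `W = D ⊎ D` for the enlargement.
    module Graph {w} {W : Set w} (k : W ↣ A) (ψ : (W × W) ↣ W) where
      open Injection k using () renaming (to to K; injective to K-injective)
      open Injection ψ using () renaming (to to Ψ; injective to Ψ-injective)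

      graph : Subset ((A × A) × A)
      graph = ⟪ (λ t → ∃[ v ] ∃[ w ] (t ≡ ((K v , K w) , K (Ψ (v , w))))) ⟫

      ∈-graph : ∀ v w → ((K v , K w) , K (Ψ (v , w))) ∈ graph
      ∈-graph v w = fromWitness (v , w , refl)

      graph-good : Good graph
      graph-good t t′ t∈ t′∈ with toWitness t∈ | toWitness t′∈
      ... | v , w , refl | v′ , w′ , refl =
        (λ eq → cong (K ∘ Ψ) (cong₂ _,_ (K-injective (cong proj₁ eq)) (K-injective (cong proj₂ eq)))) ,
        (λ eq → cong (λ (x , y) → K x , K y) (Ψ-injective (K-injective eq))) ,
        (_ , ∈-graph v v′) , (_ , _ , ∈-graph w w) , (_ , _ , ∈-graph (Ψ (v , w)) v)

    private module ℕ-Graph = Graph e pairℕ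

    module Maximal (M : Subset ((A × A) × A)) (graph⊆M : ℕ-Graph.graph ⊆ M) (good : Good M)
      (maximal : ∀ {S} → Good S → M ⊆ S → S ⊆ M)
      where

      D : Set a
      D = ∃ (_∈ ⟪ Domain M ⟫)

      E : Set a
      E = ∃ (_∈ ⟪ (λ x → ¬ (x ∈ ⟪ Domain M ⟫)) ⟫)

      subset-ext : ∀ {S : Subset A} {x y : ∃ (_∈ S)} → proj₁ x ≡ proj₁ y → x ≡ y
      subset-ext refl = cong (_ ,_) (Bool.T-irrelevant _ _)

      D↣A : D ↣ A
      D↣A = mk↣ subset-ext

      split : A ↣ (D ⊎ E)
      split = mk↣ {to = proj₁ ∘ side} λ {x} {y} eq →
        trans (sym (proj₂ (side x))) (trans (cong forget eq) (proj₂ (side y)))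
        where
        forget : D ⊎ E → A
        forget = [ proj₁ , proj₁ ]′

        side : ∀ x → Σ[ s ∈ D ⊎ E ] forget s ≡ x
        side x with lem (x ∈ ⟪ Domain M ⟫)
        ... | yes x∈ = inj₁ (x , x∈) , refl
        ... | no  x∉ = inj₂ (x , fromWitness x∉) , refl

      value : ((x , y) : D × D) → ∃[ z ] (((proj₁ x , proj₁ y) , z) ∈ M)
      value ((_ , x∈) , (_ , y∈)) with toWitness x∈ | toWitness y∈
      ... | _ , _ , t∈ | _ , _ , t′∈ = proj₁ (proj₂ (proj₂ (good _ _ t∈ t′∈)))

      φ : (D × D) ↣ D
      φ = mk↣ {to = λ p → proj₁ (value p) , fromWitness (closed p)} λ {p} {q} eq →
        let eq′ = proj₁ (proj₂ (good _ _ (proj₂ (value p)) (proj₂ (value q)))) (cong proj₁ eq)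
        in cong₂ _,_ (subset-ext (cong proj₁ eq′)) (subset-ext (cong proj₂ eq′))
        where
        closed : ∀ p → Domain M (proj₁ (value p))
        closed p = proj₂ (proj₂ (proj₂ (proj₂ (good _ _ (proj₂ (value p)) (proj₂ (value p))))))

      φ-value : ∀ x y {z} → ((proj₁ x , proj₁ y) , z) ∈ M → proj₁ (Injection.to φ (x , y)) ≡ z
      φ-value x y t∈ = proj₁ (good _ _ (proj₂ (value (x , y))) t∈) refl

      from-ℕ : ℕ → D
      from-ℕ n = Injection.to e n , fromWitness (_ , _ , graph⊆M _ (ℕ-Graph.∈-graph n n))

      from-ℕ-injective : ∀ {m n} → from-ℕ m ≡ from-ℕ n → m ≡ n
      from-ℕ-injective eq = Injection.injective e (cong proj₁ eq)

      double : (D ⊎ D) ↣ D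
      double = ⊎-square (mk↣ {to = from-ℕ} from-ℕ-injective) φ

      -- If D embeds into its complement, φ extends to the square of the union
      -- of D with the image: send all new pairs into the image.
      module Enlarge (j : D ↣ E) where
        W : Set a
        W = D ⊎ D

        k : W → A
        k = [ proj₁ , proj₁ ∘ Injection.to j ]′

        k-injective : ∀ v w → k v ≡ k w → v ≡ w
        k-injective (inj₁ _) (inj₁ _) eq = cong inj₁ (subset-ext eq)
        k-injective (inj₂ _) (inj₂ _) eq = cong inj₂ (Injection.injective j (subset-ext eq))
        k-injective (inj₁ (_ , x∈)) (inj₂ y) refl = contradiction x∈ (toWitness (proj₂ (Injection.to j y)))
        k-injective (inj₂ x) (inj₁ (_ , y∈)) refl = contradiction y∈ (toWitness (proj₂ (Injection.to j x)))

        abstract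
          θ : (W × W) ↣ D
          θ = (double ×-↣ double) ⨾ φ

        ψ : W × W → W
        ψ (inj₁ x , inj₁ y) = inj₁ (Injection.to φ (x , y))
        ψ w@(inj₁ _ , inj₂ _) = inj₂ (Injection.to θ w)
        ψ w@(inj₂ _ , _)      = inj₂ (Injection.to θ w)

        ψ-injective : ∀ v w → ψ v ≡ ψ w → v ≡ w
        ψ-injective (inj₁ _ , inj₁ _) (inj₁ _ , inj₁ _) eq =
          cong (λ (x , y) → inj₁ x , inj₁ y) (Injection.injective φ (inj₁-injective eq))
        ψ-injective (inj₁ _ , inj₂ _) (inj₁ _ , inj₂ _) eq = Injection.injective θ (inj₂-injective eq)
        ψ-injective (inj₁ _ , inj₂ _) (inj₂ _ , _)      eq = Injection.injective θ (inj₂-injective eq)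
        ψ-injective (inj₂ _ , _)      (inj₁ _ , inj₂ _) eq = Injection.injective θ (inj₂-injective eq)
        ψ-injective (inj₂ _ , _)      (inj₂ _ , _)      eq = Injection.injective θ (inj₂-injective eq)

        open Graph (mk↣ {to = k} λ {v} {w} → k-injective v w) (mk↣ {to = ψ} λ {v} {w} → ψ-injective v w)

        M⊆graph : M ⊆ graph
        M⊆graph ((x , y) , z) t∈ = fromWitness (inj₁ x⁺ , inj₁ y⁺ , cong ((x , y) ,_) (sym (φ-value x⁺ y⁺ t∈)))
          where
          x⁺ y⁺ : D
          x⁺ = x , fromWitness (_ , _ , t∈)
          y⁺ = y , fromWitness (proj₁ (proj₂ (proj₂ (proj₂ (good _ _ t∈ t∈)))))

        -- Maximality puts the larger graph inside `M`, so that a point of the image of `j` lies in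
        -- the domain of `M` and also in its complement. The copy of ℕ provides an element of `D` to
        -- start from.
        impossible : Empty.⊥
        impossible = toWitness (proj₂ (Injection.to j (from-ℕ 0)))
          (fromWitness (_ , _ , maximal graph-good M⊆graph _ (∈-graph (inj₂ (from-ℕ 0)) (inj₂ (from-ℕ 0)))))

      A↣D : E ↣ D → A ↣ D
      A↣D E↣D = split ⨾ (Identity.↣-id D ⊎-↣ E↣D) ⨾ double

      from-A↣D : A ↣ D → (A × A) ↣ A
      from-A↣D i = (i ×-↣ i) ⨾ φ ⨾ D↣A

      square-maximal : E ↣ D ⊎ D ↣ E → (A × A) ↣ A
      square-maximal (inj₁ E↣D) = from-A↣D (A↣D E↣D)
      square-maximal (inj₂ D↣E) = ⊥-elim (Enlarge.impossible D↣E)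

    square : (A × A) ↣ A
    square = let M , graph⊆M , good , maximal = Above.zorn ℕ-Graph.graph ℕ-Graph.graph-good
                 open Maximal M graph⊆M good maximal
             in square-maximal (comparable E D)

  -- Setoids as bare types; finite and infinite types.

  -- A transversal of `S` with propositional equality has the same cardinality as `S`, and every
  -- function on it is automatically a map of setoids.
  module Plain {a ℓ} (S : Setoid a ℓ) where
    open Setoid S using (Carrier; _≈_) renaming (sym to ≈-sym; trans to ≈-trans)
    open Canonical S

    Plain : Set a
    Plain = ∃[ x ] (rep x ≡ x)

    plain : Carrier → Plain
    plain x = rep x , rep-cong (rep-≈ x)

    plain-≈ : ∀ x → proj₁ (plain x) ≈ x
    plain-≈ = rep-≈

    plain-ext : ∀ {x y : Plain} → proj₁ x ≡ proj₁ y → x ≡ y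
    plain-ext refl = cong (_ ,_) (uip _ _)

    to-plain : S ≼ setoid Plain
    to-plain = record
      { to        = plain
      ; cong      = λ x≈y → plain-ext (rep-cong x≈y)
      ; injective = λ {x} {y} eq → ≈-trans (≈-sym (rep-≈ x))
                      (subst (λ z → proj₁ z ≈ y) (sym eq) (rep-≈ y))
      }

    from-plain : setoid Plain ≼ S
    from-plain = record
      { to        = proj₁
      ; cong      = λ { refl → Setoid.refl S }
      ; injective = λ {x} {y} x≈y → plain-ext (trans (sym (proj₂ x)) (trans (rep-cong x≈y) (proj₂ y)))
      }

    -- The witness is chosen at representatives only, which makes the choice respect `≈`; it is
    -- injective because a witness determines its element.
    choose-≼ : ∀ {t r} {T : Set t} (R : Carrier → T → Set r) → (∀ x → ∃ (R x)) →
               (∀ {x y t} → R x t → R y t → x ≈ y) → S ≼ setoid T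
    choose-≼ R total determines = to-plain ⨾ record
      { to        = proj₁ ∘ choice
      ; cong      = cong (proj₁ ∘ choice)
      ; injective = λ {x} {y} eq → Injection.injective from-plain
          (determines (proj₂ (choice x)) (subst (R (proj₁ y)) (sym eq) (proj₂ (choice y))))
      }
      where
      choice : (x : Plain) → ∃ (R (proj₁ x))
      choice x = total (proj₁ x)

  listed-≼ : ∀ {a ℓ p} (S : Setoid a ℓ) {X : Pred (Setoid.Carrier S) p} → let open Setoid S in
             ∀ ys → (∀ x → X x → Any (x ≈_) ys) → ⟨ S ∣ X ⟩ ≼ setoid (Fin (length ys))
  listed-≼ S ys ∈-ys = Plain.choose-≼ ⟨ S ∣ _ ⟩ (λ (x , _) i → x ≈ lookup ys i)
    (λ (x , x∈X) → Any.index (∈-ys x x∈X) , Any.lookup-index (∈-ys x x∈X))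
    λ x≈ y≈ → ≈-trans x≈ (≈-sym y≈)
    where open Setoid S using (_≈_) renaming (sym to ≈-sym; trans to ≈-trans)

  -- If no finite list exhausts `A`, every stage can pick an element outside the list of those
  -- picked before.
  listed-or-infinite : ∀ {a} (A : Set a) → (Σ[ xs ∈ List A ] ∀ x → x ∈ₗ xs) ⊎ ℕ ↣ A
  listed-or-infinite A with lem (Σ[ xs ∈ List A ] ∀ x → x ∈ₗ xs)
  ... | yes listed = inj₁ listed
  ... | no ¬listed = inj₂ (mk↣ {to = e} λ {m} {n} → e-injective m n)
    where
    fresh : ∀ xs → ∃[ x ] ¬ (x ∈ₗ xs)
    fresh xs = decidable-stable (lem _) λ none →
      ¬listed (xs , λ x → decidable-stable (lem _) λ x∉ → none (x , x∉))

    stage : ℕ → List A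
    stage zero    = []
    stage (suc n) = proj₁ (fresh (stage n)) ∷ stage n

    e : ℕ → A
    e n = proj₁ (fresh (stage n))

    e-∈-stage : ∀ {m n} → m <′ n → e m ∈ₗ stage n
    e-∈-stage ≤′-refl       = here refl
    e-∈-stage (≤′-step m<n) = there (e-∈-stage m<n)

    e-< : ∀ {m n} → m < n → ¬ (e m ≡ e n)
    e-< {m} {n} m<n eq = proj₂ (fresh (stage n)) (subst (_∈ₗ stage n) eq (e-∈-stage (ℕ.<⇒<′ m<n)))

    e-injective : ∀ m n → e m ≡ e n → m ≡ n
    e-injective m n eq with ℕ.<-cmp m n
    ... | tri< m<n _ _ = contradiction eq (e-< m<n)
    ... | tri≈ _ m≡n _ = m≡n
    ... | tri> _ _ n<m = contradiction (sym eq) (e-< n<m)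

  -- Unions and products of fewer than `L` elements.

  module _ {u v} {L : Setoid u v} (inf : Infinite L) where
    open Plain L using () renaming (Plain to L′; to-plain to L≼L′; from-plain to L′≼L)

    private
      ℕ↣L′ : ℕ ↣ L′
      ℕ↣L′ = inf ⨾ L≼L′

      L′-square : (L′ × L′) ↣ L′
      L′-square = Hessenberg.square L′ ℕ↣L′

    -- An injection f : L × L → X ⊎ Y either maps a row into X, or every row has
    -- an element that f maps into Y.
    ⊎-≺ : ∀ {x y} {X : Set x} {Y : Set y} → setoid X ≺ L → setoid Y ≺ L → setoid (X ⊎ Y) ≺ L
    ⊎-≺ {X = X} {Y} (X≼L , L⋠X) (Y≼L , L⋠Y) =
      ((X≼L ⨾ L≼L′) ⊎-↣ (Y≼L ⨾ L≼L′)) ⨾ ⊎-square ℕ↣L′ L′-square ⨾ L′≼L ,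
      λ L≼X⊎Y → no-injection (L′-square ⨾ L′≼L ⨾ L≼X⊎Y)
      where
      no-injection : ¬ ((L′ × L′) ↣ (X ⊎ Y))
      no-injection i with lem (∃[ l ] ∀ m → ∃[ x ] (Injection.to i (l , m) ≡ inj₁ x))
      ... | yes (l , row) = L⋠X (L≼L′ ⨾ mk↣ {to = proj₁ ∘ row} λ {m} {n} eq →
        cong proj₂ (Injection.injective i (trans (proj₂ (row m)) (trans (cong inj₁ eq) (sym (proj₂ (row n)))))))
      ... | no ¬row = L⋠Y (L≼L′ ⨾ mk↣ {to = proj₁ ∘ proj₂ ∘ column} λ {m} {n} eq →
        cong proj₁ (Injection.injective i
          (trans (proj₂ (proj₂ (column m))) (trans (cong inj₂ eq) (sym (proj₂ (proj₂ (column n))))))))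
        where
        column : ∀ l → ∃[ m ] ∃[ y ] (Injection.to i (l , m) ≡ inj₂ y)
        column l = decidable-stable (lem _) λ none → ¬row (l , λ m → side none m (Injection.to i (l , m)) refl)
          where
          side : ¬ (∃[ m ] ∃[ y ] (Injection.to i (l , m) ≡ inj₂ y)) →
                 ∀ m z → Injection.to i (l , m) ≡ z → ∃[ x ] (Injection.to i (l , m) ≡ inj₁ x)
          side _    m (inj₁ x) eq = x , eq
          side none m (inj₂ y) eq = contradiction (m , y , eq) none

    ∪-≺ : ∀ {a ℓ p q} (S : Setoid a ℓ) {X : Pred (Setoid.Carrier S) p} {Y : Pred (Setoid.Carrier S) q} →
          ⟨ S ∣ X ⟩ ≺ L → ⟨ S ∣ Y ⟩ ≺ L → ⟨ S ∣ (λ z → X z ⊎ Y z) ⟩ ≺ L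
    ∪-≺ S {X} {Y} X≺L Y≺L = ≼-≺-trans
      (Plain.choose-≼ ⟨ S ∣ (λ z → X z ⊎ Y z) ⟩ R
        (λ { (z , inj₁ z∈X) → inj₁ (X.plain (z , z∈X)) , ≈-sym (X.plain-≈ (z , z∈X))
           ; (z , inj₂ z∈Y) → inj₂ (Y.plain (z , z∈Y)) , ≈-sym (Y.plain-≈ (z , z∈Y)) })
        λ { {t = inj₁ _} z≈ w≈ → ≈-trans z≈ (≈-sym w≈) ; {t = inj₂ _} z≈ w≈ → ≈-trans z≈ (≈-sym w≈) })
      (⊎-≺ (≼-≺-trans X.from-plain X≺L) (≼-≺-trans Y.from-plain Y≺L))
      where
      open Setoid S using (_≈_) renaming (sym to ≈-sym; trans to ≈-trans)
      module X = Plain ⟨ S ∣ X ⟩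
      module Y = Plain ⟨ S ∣ Y ⟩

      R : ∃ (λ z → X z ⊎ Y z) → X.Plain ⊎ Y.Plain → Set _
      R (z , _) (inj₁ x) = z ≈ proj₁ (proj₁ x)
      R (z , _) (inj₂ y) = z ≈ proj₁ (proj₁ y)

    module _ {c ℓ} (M : IdempotentCommutativeMonoid c ℓ) where
      open IdempotentCommutativeMonoid M using (Carrier; _≈_; ∙-cong)
        renaming (setoid to M-setoid; refl to ≈-refl; sym to ≈-sym; trans to ≈-trans)
      open Products M

      -- An infinite `X` has no more finite lists than elements. A nonempty finite `X` has
      -- infinitely many lists, too many for a countable `L`; there idempotence leaves only the
      -- finitely many subproducts.
      Products-≺ : ∀ {p} {X : Pred Carrier p} → ⟨ M-setoid ∣ X ⟩ ≺ L → ⟨ M-setoid ∣ Products X ⟩ ≺ L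
      Products-≺ {X = X} X≺L = [ listed , infinite ]′ (listed-or-infinite Plain)
        where
        open Plain ⟨ M-setoid ∣ X ⟩

        values : List Plain → List Carrier
        values = map (proj₁ ∘ proj₁)

        listed : (Σ[ xs ∈ List Plain ] ∀ x → x ∈ₗ xs) → ⟨ M-setoid ∣ Products X ⟩ ≺ L
        listed (xs , x∈) = ≼-≺-trans (listed-≼ M-setoid (subproducts (values xs)) λ y (ws , y≈) →
          Any.map (≈-trans y≈) (product-∈ (values xs) (map proj₁ ws) (All.map⁺ (All.universal ∈-values ws))))
          (Fin-≺ inf _)
          where
          ∈-values : ∀ w → Any (proj₁ w ≈_) (values xs)
          ∈-values w = Any.map⁺ (Any.map (λ { refl → ≈-sym (plain-≈ w) }) (x∈ (plain w)))

        infinite : ℕ ↣ Plain → ⟨ M-setoid ∣ Products X ⟩ ≺ L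
        infinite ℕ↣X = ≼-≺-trans
          (Plain.choose-≼ ⟨ M-setoid ∣ Products X ⟩
            (λ (y , _) ps → y ≈ product (values ps))
            (λ (y , ws , y≈) → map plain ws , ≈-trans y≈ (product-plain ws))
            (λ y≈ z≈ → ≈-trans y≈ (≈-sym z≈))
           ⨾ List-square ℕ↣X (Hessenberg.square _ ℕ↣X) ⨾ from-plain)
          X≺L
          where
          product-plain : ∀ ws → product (map proj₁ ws) ≈ product (values (map plain ws))
          product-plain []       = ≈-refl
          product-plain (w ∷ ws) = ∙-cong (≈-sym (plain-≈ w)) (product-plain ws)

  -- Ultrafilters.

  open BooleanHomomorphism using (⟦_⟧)

  T-not : ∀ {b} → ¬ T b → T (not b)
  T-not {true}  ¬t = ¬t _
  T-not {false} _  = _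

  -- The prime ideal theorem, by Zorn's lemma: a maximal filter through x is
  -- the preimage of true under a homomorphism.
  module Ultrafilter {c ℓ} (A : BooleanAlgebra c ℓ) {x : BooleanAlgebra.Carrier A}
    (x≉⊥ : BooleanAlgebra._≉_ A x (BooleanAlgebra.⊥ A))
    where
    open BooleanOrder A

    -- The nonempty good sets are the proper filters.
    Φ : Subset Carrier → Carrier → Carrier → Set (c ⊔ ℓ)
    Φ S t t′ = ((t ∧ t′) ∈ S) × (∀ y → t ≤ y → y ∈ S) × ¬ (t ≈ ⊥)

    Φ-mono : ∀ {S S′ t t′} → S ⊆ S′ → Φ S t t′ → Φ S′ t t′
    Φ-mono S⊆S′ (meet , up , t≉⊥) = S⊆S′ _ meet , (λ y t≤y → S⊆S′ y (up y t≤y)) , t≉⊥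

    open Zorn Φ (λ {S} {S′} {t} {t′} → Φ-mono {S} {S′} {t} {t′})

    principal-good : Good ⟪ x ≤_ ⟫
    principal-good t t′ x≤t x≤t′ =
      fromWitness (∧-greatest (toWitness x≤t) (toWitness x≤t′)) ,
      (λ y t≤y → fromWitness (≤-trans (toWitness x≤t) t≤y)) ,
      (λ t≈⊥ → x≉⊥ (≤⊥⇒≈⊥ (≤-respʳ t≈⊥ (toWitness x≤t))))

    module Maximal (M : Subset Carrier) (x∈M : x ∈ M) (good : Good M)
      (maximal : ∀ {S} → Good S → M ⊆ S → S ⊆ M)
      where

      up : ∀ {y z} → y ∈ M → y ≤ z → z ∈ M
      up y∈M y≤z = proj₁ (proj₂ (good _ _ y∈M y∈M)) _ y≤z

      -- If some member of `M` is disjoint from `z`, it lies below `∁ z`. Otherwise the filter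
      -- generated by `M` and `z` is proper, and maximality gives `z ∈ M`.
      prime : ∀ {z} → ¬ (z ∈ M) → (∁ z) ∈ M
      prime {z} z∉M with lem (∃[ t ] (t ∈ M × t ∧ z ≈ ⊥))
      ... | yes (t , t∈M , t∧z≈⊥) = up t∈M (disjoint⇒≤∁ t∧z≈⊥)
      ... | no ¬disjoint = contradiction
        (maximal M⁺-good (λ t t∈M → fromWitness (t , t∈M , x∧y≤x t z)) z (fromWitness (x , x∈M , x∧y≤y x z))) z∉M
        where
        M⁺ : Carrier → Set (c ⊔ ℓ)
        M⁺ y = ∃[ t ] (t ∈ M × t ∧ z ≤ y)

        M⁺-good : Good ⟪ M⁺ ⟫
        M⁺-good y y′ y∈ y′∈ with toWitness y∈ | toWitness y′∈
        ... | t , t∈M , t∧z≤y | t′ , t′∈M , t′∧z≤y′ =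
          fromWitness (t ∧ t′ , proj₁ (good t t′ t∈M t′∈M) , ∧-greatest
            (≤-trans (∧-greatest (≤-trans (x∧y≤x _ z) (x∧y≤x t t′)) (x∧y≤y _ z)) t∧z≤y)
            (≤-trans (∧-greatest (≤-trans (x∧y≤x _ z) (x∧y≤y t t′)) (x∧y≤y _ z)) t′∧z≤y′)) ,
          (λ w y≤w → fromWitness (t , t∈M , ≤-trans t∧z≤y y≤w)) ,
          (λ y≈⊥ → ¬disjoint (t , t∈M , ≤⊥⇒≈⊥ (≤-respʳ y≈⊥ t∧z≤y)))

      χ : BooleanHomomorphism A Bool.∨-∧-booleanAlgebra
      χ = ∧-∁-homomorphism M
        (λ y≈z → T-ext (λ y∈ → up y∈ (≤-reflexive y≈z)) (λ z∈ → up z∈ (≤-reflexive (≈-sym y≈z))))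
        (λ y z → T-ext
          (λ ∈M → Equivalence.from Bool.T-∧ (up ∈M (x∧y≤x y z) , up ∈M (x∧y≤y y z)))
          (λ both → let y∈ , z∈ = Equivalence.to Bool.T-∧ both in proj₁ (good y z y∈ z∈)))
        (λ y → T-ext
          (λ ∁y∈ → T-not λ y∈ → let ∈M = proj₁ (good _ _ y∈ ∁y∈) in
            proj₂ (proj₂ (good _ _ ∈M ∈M)) (∧-complementʳ y))
          (λ y∉ → prime (T-not⁻ y∉)))
        where
        T-not⁻ : ∀ {b} → T (not b) → ¬ T b
        T-not⁻ {false} _ ()

    separating : Σ[ χ ∈ BooleanHomomorphism A Bool.∨-∧-booleanAlgebra ] T (⟦ χ ⟧ x)
    separating =
      let M , ⊆M , good , maximal = Above.zorn ⟪ x ≤_ ⟫ principal-good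
          x∈M = ⊆M x (fromWitness ≤-refl)
      in Maximal.χ M x∈M good maximal , x∈M

  -- Independence of the factors and disjunctive normal forms in a coproduct.

  module CoproductProperties {c ℓ} {I : Set c} {Bᵢ : I → BooleanAlgebra c ℓ} {B : BooleanAlgebra c ℓ}
    (isCoproduct : IsCoproduct Bᵢ B)
    where
    open IsCoproduct isCoproduct
    open BooleanOrder B
    module Bᵢ i = BooleanOrder (Bᵢ i)
    module ι i = Homomorphism (ι i)

    Literal : Set c
    Literal = Σ I Bᵢ.Carrier

    ⟦_⟧ₗ : Literal → Carrier
    ⟦ i , x ⟧ₗ = ι.⟦_⟧ i x

    meet : List Literal → Carrier
    meet = foldr (λ l b → ⟦ l ⟧ₗ ∧ b) ⊤

    join : List (List Literal) → Carrier
    join = foldr (λ m b → meet m ∨ b) ⊥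

    -- A literal from another factor imposes no condition at `i`, hence the default `⊤`.
    restrict : ∀ i {j} → Dec (j ≡ i) → Bᵢ.Carrier j → Bᵢ.Carrier i
    restrict i (yes refl) x = x
    restrict i (no _)     x = Bᵢ.⊤ i

    coordinate : ∀ i → List Literal → Bᵢ.Carrier i
    coordinate i = foldr (λ (j , x) y → Bᵢ._∧_ i (restrict i (lem (j ≡ i)) x) y) (Bᵢ.⊤ i)

    literal-≤ : ∀ i {j} (j≟i : Dec (j ≡ i)) x → ⟦ j , x ⟧ₗ ≤ ι.⟦_⟧ i (restrict i j≟i x)
    literal-≤ i (yes refl) x = ≤-refl
    literal-≤ i (no _)     x = ≤-respʳ (≈-sym (ι.⊤-homo i)) (≤⊤ _)

    meet-≤ : ∀ i m → meet m ≤ ι.⟦_⟧ i (coordinate i m)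
    meet-≤ i []            = ≤-reflexive (≈-sym (ι.⊤-homo i))
    meet-≤ i ((j , x) ∷ m) = ≤-respʳ (≈-sym (ι.∧-homo i _ _)) (∧-greatest
      (≤-trans (x∧y≤x _ _) (literal-≤ i (lem (j ≡ i)) x)) (≤-trans (x∧y≤y _ _) (meet-≤ i m)))

    coordinate-⊥ : ∀ m i → Bᵢ._≈_ i (coordinate i m) (Bᵢ.⊥ i) → meet m ≈ ⊥
    coordinate-⊥ m i mᵢ≈⊥ = ≤⊥⇒≈⊥ (≤-respʳ (≈-trans (ι.⟦⟧-cong i mᵢ≈⊥) (ι.⊥-homo i)) (meet-≤ i m))

    restrict-self : ∀ i (i≟i : Dec (i ≡ i)) x → Bᵢ._≤_ i (restrict i i≟i x) x
    restrict-self i (yes refl) x = Bᵢ.≤-refl i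
    restrict-self i (no i≢i)   x = contradiction refl i≢i

    coordinate-≤ : ∀ {i x m} → (i , x) ∈ₗ m → Bᵢ._≤_ i (coordinate i m) x
    coordinate-≤ {i} {x} (here refl) = Bᵢ.≤-trans i (Bᵢ.x∧y≤x i _ _) (restrict-self i (lem (i ≡ i)) x)
    coordinate-≤ {i}     (there l∈m) = Bᵢ.≤-trans i (Bᵢ.x∧y≤y i _ _) (coordinate-≤ l∈m)

    support : List Literal → List I
    support = map proj₁

    restrict-support : ∀ i {j} (j≟i : Dec (j ≡ i)) x → i ≡ j ⊎ Bᵢ._≈_ i (restrict i j≟i x) (Bᵢ.⊤ i)
    restrict-support i (yes refl) x = inj₁ refl
    restrict-support i (no _)     x = inj₂ (Bᵢ.≈-refl i)

    -- Allows `entries` to be finite: only the finitely many factors that a clause mentions need a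
    -- coordinate.
    coordinate-support : ∀ i m → i ∈ₗ support m ⊎ Bᵢ._≈_ i (coordinate i m) (Bᵢ.⊤ i)
    coordinate-support i [] = inj₂ (Bᵢ.≈-refl i)
    coordinate-support i ((j , x) ∷ m) with restrict-support i (lem (j ≡ i)) x | coordinate-support i m
    ... | inj₁ i≡j | _         = inj₁ (here i≡j)
    ... | inj₂ _   | inj₁ i∈m  = inj₁ (there i∈m)
    ... | inj₂ ≈⊤  | inj₂ ≈⊤′ = inj₂ (Bᵢ.≈-trans i (Bᵢ.∧-cong i ≈⊤ ≈⊤′) (Bᵢ.∧-idem i _))

    coordinate-++ : ∀ i m n → Bᵢ._≈_ i (coordinate i (m ++ n)) (Bᵢ._∧_ i (coordinate i m) (coordinate i n))
    coordinate-++ i []      n = Bᵢ.≈-sym i (Bᵢ.∧-identityˡ i _)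
    coordinate-++ i (l ∷ m) n =
      Bᵢ.≈-trans i (Bᵢ.∧-congˡ i (coordinate-++ i m n)) (Bᵢ.≈-sym i (Bᵢ.∧-assoc i _ _ _))

    meet-++ : ∀ m n → meet (m ++ n) ≈ meet m ∧ meet n
    meet-++ []      n = ≈-sym (∧-identityˡ _)
    meet-++ (l ∷ m) n = ≈-trans (∧-congˡ (meet-++ m n)) (≈-sym (∧-assoc _ _ _))

    join-++ : ∀ ms ns → join (ms ++ ns) ≈ join ms ∨ join ns
    join-++ []       ns = ≈-sym (∨-identityˡ _)
    join-++ (m ∷ ms) ns = ≈-trans (∨-congˡ (join-++ ms ns)) (≈-sym (∨-assoc _ _ _))

    -- Otherwise ultrafilters containing the coordinates induce a homomorphism
    -- from the coproduct to the two-element algebra that does not vanish on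
    -- meet m.
    meet-⊥ : ∀ m → meet m ≈ ⊥ → ∃[ i ] Bᵢ._≈_ i (coordinate i m) (Bᵢ.⊥ i)
    meet-⊥ m m≈⊥ = decidable-stable (lem _) λ none → nonzero λ i i≈⊥ → none (i , i≈⊥)
      where
      nonzero : ¬ (∀ i → ¬ (Bᵢ._≈_ i (coordinate i m) (Bᵢ.⊥ i)))
      nonzero ≉⊥ = subst T (trans (h.⟦⟧-cong m≈⊥) h.⊥-homo) (h-meet m χ-literal)
        where
        -- This copy of the two-element algebra lives in the universe for which the universal
        -- property is stated.
        module 𝟚 = Generated ℓ Bool.∨-∧-booleanAlgebra {V = Lift c Bool} lower

        separated : ∀ i → Σ[ χ ∈ BooleanHomomorphism (Bᵢ i) Bool.∨-∧-booleanAlgebra ] T (⟦ χ ⟧ (coordinate i m))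
        separated i = Ultrafilter.separating (Bᵢ i) (≉⊥ i)

        module χ i = Homomorphism (proj₁ (separated i))

        mediator = mediate 𝟚.generated λ i → 𝟚.corestrict (proj₁ (separated i)) (lift ∘ χ.⟦_⟧ i) λ _ → refl

        module h = Homomorphism (𝟚.evaluation ∘ₕ proj₁ mediator)

        χ-literal : ∀ {i x} → (i , x) ∈ₗ m → T (χ.⟦_⟧ i x)
        χ-literal {i} l∈m = proj₂ (Equivalence.to Bool.T-∧
          (subst T (χ.⟦⟧-mono i (coordinate-≤ l∈m)) (proj₂ (separated i))))

        h-meet : ∀ n → (∀ {i x} → (i , x) ∈ₗ n → T (χ.⟦_⟧ i x)) → T (h.⟦_⟧ (meet n))
        h-meet []            _    = subst T (sym h.⊤-homo) _
        h-meet ((i , x) ∷ n) true-on = subst T (sym (h.∧-homo _ _)) (Equivalence.from Bool.T-∧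
          (subst T (sym (lower (proj₂ mediator i x))) (true-on (here refl)) , h-meet n (true-on ∘ there)))

    distribute : List (List Literal) → List (List Literal) → List (List Literal)
    distribute []       ns = []
    distribute (m ∷ ms) ns = map (m ++_) ns ++ distribute ms ns

    join-map-++ : ∀ m ns → join (map (m ++_) ns) ≈ meet m ∧ join ns
    join-map-++ m []       = ≈-sym (∧-zeroʳ _)
    join-map-++ m (n ∷ ns) = ≈-trans (∨-cong (meet-++ m n) (join-map-++ m ns)) (≈-sym (∧-distribˡ-∨ _ _ _))

    join-distribute : ∀ ms ns → join (distribute ms ns) ≈ join ms ∧ join ns
    join-distribute []       ns = ≈-sym (∧-zeroˡ _)
    join-distribute (m ∷ ms) ns = ≈-trans (join-++ (map (m ++_) ns) _)
      (≈-trans (∨-cong (join-map-++ m ns) (join-distribute ms ns)) (≈-sym (∧-distribʳ-∨ _ _ _)))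

    DNF : Carrier → Set (c ⊔ ℓ)
    DNF y = Σ[ ms ∈ List (List Literal) ] y ≈ join ms

    DNF-resp : ∀ {y z} → y ≈ z → DNF y → DNF z
    DNF-resp y≈z (ms , y≈) = ms , ≈-trans (≈-sym y≈z) y≈

    DNF-∨ : ∀ {y z} → DNF y → DNF z → DNF (y ∨ z)
    DNF-∨ (ms , y≈) (ns , z≈) = ms ++ ns , ≈-trans (∨-cong y≈ z≈) (≈-sym (join-++ ms ns))

    DNF-∧ : ∀ {y z} → DNF y → DNF z → DNF (y ∧ z)
    DNF-∧ (ms , y≈) (ns , z≈) = distribute ms ns , ≈-trans (∧-cong y≈ z≈) (≈-sym (join-distribute ms ns))

    DNF-⊥ : DNF ⊥
    DNF-⊥ = [] , ≈-refl

    DNF-⊤ : DNF ⊤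
    DNF-⊤ = [] ∷ [] , ≈-sym (∨-identityʳ _)

    DNF-literal : ∀ l → DNF ⟦ l ⟧ₗ
    DNF-literal l = (l ∷ []) ∷ [] , ≈-sym (≈-trans (∨-identityʳ _) (∧-identityʳ _))

    open Generated ℓ B ⟦_⟧ₗ using (eval; generated; evaluation; corestrict)

    -- Carrying the normal form of the complement along makes complementation a swap; De Morgan
    -- handles meets and joins.
    DNF-eval : ∀ t → DNF (eval t) × DNF (∁ eval t)
    DNF-eval (var (i , x)) = DNF-literal (i , x) , DNF-resp (ι.¬-homo i x) (DNF-literal (i , Bᵢ.∁_ i x))
    DNF-eval (s ∧ₜ t) = let s⁺ , s⁻ = DNF-eval s ; t⁺ , t⁻ = DNF-eval t in
      DNF-∧ s⁺ t⁺ , DNF-resp (≈-sym (deMorgan₁ _ _)) (DNF-∨ s⁻ t⁻)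
    DNF-eval (s ∨ₜ t) = let s⁺ , s⁻ = DNF-eval s ; t⁺ , t⁻ = DNF-eval t in
      DNF-∨ s⁺ t⁺ , DNF-resp (≈-sym (deMorgan₂ _ _)) (DNF-∧ s⁻ t⁻)
    DNF-eval (∁ₜ t)   = let t⁺ , t⁻ = DNF-eval t in t⁻ , DNF-resp (≈-sym (∁-involutive _)) t⁺
    DNF-eval ⊤ₜ       = DNF-⊤ , DNF-resp (≈-sym ∁⊤≈⊥) DNF-⊥
    DNF-eval ⊥ₜ       = DNF-⊥ , DNF-resp (≈-sym ∁⊥≈⊤) DNF-⊤

    abstract
      -- The mediating map into the subalgebra generated by the factors, followed by the inclusion,
      -- agrees with the identity on every factor. By uniqueness it is the identity, so `y` is the
      -- value of a term.
      DNF-exists : ∀ y → DNF y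
      DNF-exists y =
        let h , h-extends = mediate generated λ i → corestrict (ι i) (i ,_) λ _ → ≈-refl
        in DNF-resp
          (unique B ι (evaluation ∘ₕ h) (identity B) (λ i x → lower (h-extends i x)) (λ _ _ → ≈-refl) y)
          (proj₁ (DNF-eval (⟦ h ⟧ y)))

    coordinates : List Literal → List Literal
    coordinates m = map (λ i → i , coordinate i m) (support m)

    ∁ₗ : Literal → Literal
    ∁ₗ (i , x) = i , Bᵢ.∁_ i x

    -- For `p ≤ q`, the lower end of an interpolation inside a factor comes from a clause of `p`,
    -- the upper end from the complement of a clause of `∁ q`.
    lower-coordinates upper-coordinates : Carrier → List Literal
    lower-coordinates y = concatMap coordinates (proj₁ (DNF-exists y))
    upper-coordinates y = map ∁ₗ (concatMap coordinates (proj₁ (DNF-exists (∁ y))))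

    ∈-concatMap-coordinates : ∀ {i m ms} → i ∈ₗ support m → m ∈ₗ ms →
                              (i , coordinate i m) ∈ₗ concatMap coordinates ms
    ∈-concatMap-coordinates i∈m m∈ms = ∈-concatMap⁺ coordinates (lose m∈ms (∈-map⁺ _ i∈m))

    open Canonical ≈-setoid

    -- f(y) and g(y) on the coproduct are generated by the values of the given
    -- maps at these elements of the factors.
    entries : Carrier → List Literal
    entries y = lower-coordinates y ++ upper-coordinates y

    -- The candidate interpolants and their number.

    module ∧-Products = Products ∧-idempotentCommutativeMonoid
    module ∨-Products = Products ∨-idempotentCommutativeMonoid
    open ∧-Products using () renaming (Products to Meets)
    open ∨-Products using () renaming (Products to Joins)

    module Generators (f : ∀ i → Bᵢ.Carrier i → Pred (Bᵢ.Carrier i) (c ⊔ ℓ)) where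

      Image : Carrier → Literal → Set (c ⊔ ℓ)
      Image y (i , x) = ∃[ z ] (f i x z × y ≈ ι.⟦_⟧ i z)

      -- The constants `⊤` and `⊥` interpolate when one of the two clauses vanishes in a factor by
      -- itself.
      Generator : List Literal → Pred Carrier (c ⊔ ℓ)
      Generator ls y = (y ≈ ⊤ ⊎ y ≈ ⊥) ⊎ Any (Image y) ls

      Interpolants : Carrier → Pred Carrier (c ⊔ ℓ)
      Interpolants y = Joins (Meets (Generator (entries y)))

      module Small {u v} {L : Setoid u v} (inf : Infinite L) (f≺L : ∀ i x → ⟨ Bᵢ.≈-setoid i ∣ f i x ⟩ ≺ L) where

        image-≺ : ∀ l → ⟨ ≈-setoid ∣ (λ y → Image y l) ⟩ ≺ L
        image-≺ (i , x) = ≼-≺-trans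
          (Plain.choose-≼ ⟨ ≈-setoid ∣ (λ y → Image y (i , x)) ⟩
            (λ (y , _) z → y ≈ ι.⟦_⟧ i (proj₁ (proj₁ z)))
            (λ (y , z , z∈ , y≈) → plain (z , z∈) , ≈-trans y≈ (ι.⟦⟧-cong i (Bᵢ.≈-sym i (plain-≈ (z , z∈)))))
            (λ y≈ y′≈ → ≈-trans y≈ (≈-sym y′≈))
           ⨾ from-plain)
          (f≺L i x)
          where open Plain ⟨ Bᵢ.≈-setoid i ∣ f i x ⟩

        images-≺ : ∀ ls → ⟨ ≈-setoid ∣ (λ y → Any (Image y) ls) ⟩ ≺ L
        images-≺ []       = ≼-≺-trans (listed-≼ ≈-setoid [] λ _ ()) (Fin-≺ inf 0)
        images-≺ (l ∷ ls) = ≼-≺-trans (⊆-≼ ≈-setoid λ _ → Any.toSum) (∪-≺ inf ≈-setoid (image-≺ l) (images-≺ ls))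

        interpolants-≺ : ∀ y → ⟨ ≈-setoid ∣ Interpolants y ⟩ ≺ L
        interpolants-≺ y =
          Products-≺ inf ∨-idempotentCommutativeMonoid (Products-≺ inf ∧-idempotentCommutativeMonoid
            (∪-≺ inf ≈-setoid
              (≼-≺-trans (listed-≼ ≈-setoid (⊤ ∷ ⊥ ∷ []) λ { _ (inj₁ ≈⊤) → here ≈⊤ ; _ (inj₂ ≈⊥) → there (here ≈⊥) })
                (Fin-≺ inf 2))
              (images-≺ (entries y))))

        interpolants : Func ≈-setoid ([ ≈-setoid ]^< L)
        interpolants = record
          { to   = λ y → record
            -- Normal forms are chosen element by element and may differ for equal elements; passing
            -- to the representative restores congruence.
            { member   = Interpolants (rep y)
            ; respects = λ z≈w (ws , z≈) → ws , ≈-trans (≈-sym z≈w) z≈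
            ; small    = interpolants-≺ (rep y)
            }
          ; cong = λ {y} y≈z → subst (λ r → Interpolants (rep y) ≐ Interpolants r) (rep-cong y≈z) (id , id)
          }

    -- Interpolation between normal forms.

    meets-between : ∀ {p} {Z : Pred Carrier p} {x} ns →
      (∀ {n} → n ∈ₗ ns → ∃[ z ] (Z z × x ≤ z × z ≤ ∁ meet n)) →
      ∃[ z ] (Meets Z z × x ≤ z × z ≤ ∁ join ns)
    meets-between []       _       = ⊤ , ([] , ≈-refl) , ≤⊤ _ , ≤-reflexive (≈-sym ∁⊥≈⊤)
    meets-between (n ∷ ns) between with between (here refl) | meets-between ns (between ∘ there)
    ... | z , z∈Z , x≤z , z≤ | w , (ws , w≈) , x≤w , w≤ =
      z ∧ w , ((z , z∈Z) ∷ ws , ∧-congˡ w≈) , ∧-greatest x≤z x≤w ,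
      ≤-respʳ (≈-sym (deMorgan₂ _ _)) (∧-greatest (≤-trans (x∧y≤x z w) z≤) (≤-trans (x∧y≤y z w) w≤))

    joins-between : ∀ {p} {Z : Pred Carrier p} {y} ms →
      (∀ {m} → m ∈ₗ ms → ∃[ z ] (Z z × meet m ≤ z × z ≤ y)) →
      ∃[ z ] (Joins Z z × join ms ≤ z × z ≤ y)
    joins-between []       _       = ⊥ , ([] , ≈-refl) , ≤-refl , ⊥≤ _
    joins-between (m ∷ ms) between with between (here refl) | joins-between ms (between ∘ there)
    ... | z , z∈Z , m≤z , z≤y | w , (ws , w≈) , ms≤w , w≤y =
      z ∨ w , ((z , z∈Z) ∷ ws , ∨-congˡ w≈) ,
      ∨-least (≤-trans m≤z (x≤x∨y z w)) (≤-trans ms≤w (y≤x∨y z w)) , ∨-least z≤y w≤y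

    meet-≤-join : ∀ {m ms} → m ∈ₗ ms → meet m ≤ join ms
    meet-≤-join (here refl) = x≤x∨y _ _
    meet-≤-join (there m∈)  = ≤-trans (meet-≤-join m∈) (y≤x∨y _ _)

    -- Each clause of `x` lies below the complement of each clause of `∁ y`, so clausewise
    -- interpolants suffice. The inner meets run over `ns`, the outer joins over `ms`.
    dnf-between : ∀ {p} {Z : Pred Carrier p} {x y} ms ns → x ≈ join ms → ∁ y ≈ join ns → x ≤ y →
      (∀ {m n} → m ∈ₗ ms → n ∈ₗ ns → meet m ≤ ∁ meet n → ∃[ z ] (Z z × meet m ≤ z × z ≤ ∁ meet n)) →
      ∃[ z ] (Joins (Meets Z) z × x ≤ z × z ≤ y)
    dnf-between {x = x} {y} ms ns x≈ms ∁y≈ns x≤y between =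
      let z , z∈ , ms≤z , z≤∁ns = joins-between ms λ m∈ → meets-between ns λ n∈ → between m∈ n∈
            (≤-trans (meet-≤-join m∈) (≤-trans ms≤∁ns (∁-antitone (meet-≤-join n∈))))
      in z , z∈ , ≤-respˡ (≈-sym x≈ms) ms≤z , ≤-respʳ (≈-sym y≈∁ns) z≤∁ns
      where
      y≈∁ns : y ≈ ∁ join ns
      y≈∁ns = ≈-trans (≈-sym (∁-involutive y)) (∁-cong ∁y≈ns)

      ms≤∁ns : join ms ≤ ∁ join ns
      ms≤∁ns = ≤-respˡ x≈ms (≤-respʳ y≈∁ns x≤y)

    -- Keeping `f` and `g` arbitrary lets one argument yield both halves of the FN condition, the
    -- second with the two maps exchanged.
    module Interpolation (f g : ∀ i → Bᵢ.Carrier i → Pred (Bᵢ.Carrier i) (c ⊔ ℓ))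
      (between : ∀ i {x y} → Bᵢ._≤_ i x y → ∃[ z ] (f i x z × g i y z × Bᵢ._≤_ i x z × Bᵢ._≤_ i z y))
      where
      module F = Generators f
      module G = Generators g

      Separated : List Literal → List Literal → (p q : Carrier) → Set (c ⊔ ℓ)
      Separated m n p q =
        ∃[ z ] ((F.Generator (entries p) z × G.Generator (entries q) z) × meet m ≤ z × z ≤ ∁ meet n)

      separated-⊤ : ∀ {m n p q} i → Bᵢ._≈_ i (coordinate i n) (Bᵢ.⊥ i) → Separated m n p q
      separated-⊤ {n = n} i nᵢ≈⊥ = ⊤ , (inj₁ (inj₁ ≈-refl) , inj₁ (inj₁ ≈-refl)) , ≤⊤ _ ,
        disjoint⇒≤∁ (≈-trans (∧-identityˡ _) (coordinate-⊥ n i nᵢ≈⊥))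

      separated-⊥ : ∀ {m n p q} i → Bᵢ._≈_ i (coordinate i m) (Bᵢ.⊥ i) → Separated m n p q
      separated-⊥ {m = m} i mᵢ≈⊥ = ⊥ , (inj₁ (inj₂ ≈-refl) , inj₁ (inj₂ ≈-refl)) ,
        ≤-reflexive (coordinate-⊥ m i mᵢ≈⊥) , ⊥≤ _

      separated-factor : ∀ {m n p q} i →
        (i , coordinate i m) ∈ₗ lower-coordinates p → (i , Bᵢ.∁_ i (coordinate i n)) ∈ₗ upper-coordinates q →
        Bᵢ._≤_ i (coordinate i m) (Bᵢ.∁_ i (coordinate i n)) → Separated m n p q
      separated-factor {m} {n} {p} {q} i m∈ n∈ m≤∁n =
        let z , z∈f , z∈g , m≤z , z≤∁n = between i m≤∁n in
        ι.⟦_⟧ i z ,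
        ( inj₂ (Any.++⁺ˡ {xs = lower-coordinates p} (lose m∈ (z , z∈f , ≈-refl)))
        , inj₂ (Any.++⁺ʳ (lower-coordinates q) (lose n∈ (z , z∈g , ≈-refl)))) ,
        ≤-trans (meet-≤ i m) (ι.⟦⟧-mono i m≤z) ,
        ≤-trans (ι.⟦⟧-mono i z≤∁n) (≤-respˡ (≈-sym (ι.¬-homo i _)) (∁-antitone (meet-≤ i n)))

      -- By meet-⊥ the two clauses are already separated in a single factor.
      separated : ∀ {m n p q} → m ∈ₗ proj₁ (DNF-exists p) → n ∈ₗ proj₁ (DNF-exists (∁ q)) →
                  meet m ≤ ∁ meet n → Separated m n p q
      separated {m} {n} {p} {q} m∈ n∈ m≤∁n = by-support (coordinate-support i m) (coordinate-support i n)
        where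
        vanishing : ∃[ i ] Bᵢ._≈_ i (coordinate i (m ++ n)) (Bᵢ.⊥ i)
        vanishing = meet-⊥ (m ++ n) (≈-trans (meet-++ m n) (≤∁⇒disjoint m≤∁n))

        i : I
        i = proj₁ vanishing

        open BooleanOrder (Bᵢ i) using () renaming
          (_≈_ to _≈ᵢ_; _∧_ to _∧ᵢ_; ⊤ to ⊤ᵢ; ⊥ to ⊥ᵢ; ≈-sym to symᵢ; ≈-trans to transᵢ; disjoint⇒≤∁ to disjoint⇒≤∁ᵢ
          ; ∧-congʳ to ∧-congʳᵢ; ∧-congˡ to ∧-congˡᵢ; ∧-identityʳ to ∧-identityʳᵢ; ∧-identityˡ to ∧-identityˡᵢ)

        disjoint : (coordinate i m ∧ᵢ coordinate i n) ≈ᵢ ⊥ᵢ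
        disjoint = transᵢ (symᵢ (coordinate-++ i m n)) (proj₂ vanishing)

        by-support : i ∈ₗ support m ⊎ coordinate i m ≈ᵢ ⊤ᵢ → i ∈ₗ support n ⊎ coordinate i n ≈ᵢ ⊤ᵢ →
                     Separated m n p q
        -- A clause with coordinate `⊤` at `i` leaves the other clause to vanish there alone.
        by-support (inj₂ m≈⊤) _ =
          separated-⊤ {m} {n} {p} {q} i (transᵢ (symᵢ (transᵢ (∧-congʳᵢ m≈⊤) (∧-identityˡᵢ _))) disjoint)
        by-support (inj₁ _) (inj₂ n≈⊤) =
          separated-⊥ {m} {n} {p} {q} i (transᵢ (symᵢ (transᵢ (∧-congˡᵢ n≈⊤) (∧-identityʳᵢ _))) disjoint)
        by-support (inj₁ i∈m) (inj₁ i∈n) = separated-factor {m} {n} {p} {q} i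
          (∈-concatMap-coordinates i∈m m∈) (∈-map⁺ ∁ₗ (∈-concatMap-coordinates i∈n n∈)) (disjoint⇒≤∁ᵢ disjoint)

      interpolate : ∀ {p q} → p ≤ q →
        ∃[ z ] (F.Interpolants (rep p) z × G.Interpolants (rep q) z × p ≤ z × z ≤ q)
      interpolate {p} {q} p≤q =
        let ms , p≈ms  = DNF-exists (rep p)
            ns , ∁q≈ns = DNF-exists (∁ rep q)
            -- Every generator used belongs to both sides at once, so the same combination `z` can
            -- be read as an interpolant for `p` and for `q`.
            z , z∈ , p≤z , z≤q = dnf-between {Z = λ z → F.Generator (entries (rep p)) z × G.Generator (entries (rep q)) z}
              ms ns (≈-trans (≈-sym (rep-≈ p)) p≈ms) (≈-trans (∁-cong (≈-sym (rep-≈ q))) ∁q≈ns) p≤q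
              λ {m} {n} → separated {m} {n} {rep p} {rep q}
        in z , ∨-Products.Products-mono (∧-Products.Products-mono proj₁) z∈
             , ∨-Products.Products-mono (∧-Products.Products-mono proj₂) z∈
             , p≤z , z≤q

-- The Freese-Nation property of the coproduct.

theorem2p6 : AxiomOfChoice →
    ∀ {u v u′ v′ c ℓ : Level}
    (L : Setoid u v) (K : Setoid u′ v′) →
    Infinite L → Infinite K → K ≼ L →
    (I : Set c) (Bᵢ : I → BooleanAlgebra c ℓ) →
    (∀ i → BooleanAlgebraHasFN (Bᵢ i) L K) →
    (B : BooleanAlgebra c ℓ) → IsCoproduct Bᵢ B →
    BooleanAlgebraHasFN B L K
theorem2p6 ac L K L-inf K-inf K≼L I Bᵢ fn B isCoproduct = record
  { F           = Generators.Small.interpolants f L-inf λ i x → SmallSubset.small (Func.to (HasFN.F (fn i)) x)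
  ; G           = Generators.Small.interpolants g K-inf λ i x → SmallSubset.small (Func.to (HasFN.G (fn i)) x)
  ; interpolate = λ p≤q →
      Interpolation.interpolate f g (λ i x≤y → proj₁ (HasFN.interpolate (fn i) x≤y)) p≤q ,
      Interpolation.interpolate g f (λ i x≤y → proj₂ (HasFN.interpolate (fn i) x≤y)) p≤q
  }
  where
  open CoproductProperties ac isCoproduct

  f g : ∀ i → BooleanAlgebra.Carrier (Bᵢ i) → Pred (BooleanAlgebra.Carrier (Bᵢ i)) _
  f i = HasFN.f (fn i)
  g i = HasFN.g (fn i)
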